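{- Let $\mathbb{T}(n,p)$ denote the expected number of explored nodes of the branch-and-bound algorithm for minimum dominating set described in the context, run on $G\sim\mathcal{G}(n,p)$. Then: (a) If $p=p(n)$ satisfies $pn\to\infty$ as $n\to\infty$, then $\mathbb{T}(n,p)=2^{o(n)}$ (the algorithm takes subexponential time on average). (b) If $p=c/n$ where $c\ge 20$ is a constant, then there is a constant $\epsilon\ge 0.01$ (independent of $n$) such that $\mathbb{T}(n,p)\le (2-\epsilon)^n$ for all sufficiently large $n$.
   Context: $\mathcal{G}(n,p)$ is the binomial random graph on vertex set $V=\{v_1,\dots,v_n\}$ in which each of the $\binom n2$ possible edges is present independently with probability $p$. A set $S\subseteq V$ is dominating if every vertex is in $S$ or adjacent to a vertex of $S$. Branch-and-bound algorithm: fix the order $v_1,\dots,v_n$. Nodes of the search tree are pairs $(\vec x,\delta)$ with $\delta\in\{0,\dots,n\}$ and $\vec x\in\{0,1\}^n$ with $x_i=1$ for all $i>\delta$; the node represents the vertex set $\{v_i: x_i=1\}$. The root is $((1,\dots,1),0)$. A node $(\vec x,\delta)$ with $\delta<n$ has a left child $(\vec x,\delta+1)$ (i.e. $x_{\delta+1}=1$, vertex $v_{\delta+1}$ kept) and a right child $(\vec x',\delta+1)$ where $\vec x'$ equals $\vec x$ except $x'_{\delta+1}=0$ (vertex $v_{\delta+1}$ removed). A node is feasible if its vertex set is a dominating set of $G$. The score of a node is $u(\vec x,\delta)=|\vec x|-n+\delta$, where $|\vec x|=\sum_i x_i$; equivalently, the number of indices $i\le\delta$ with $x_i=1$. Initially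 the root is explored. At each step, among the feasible nodes that are children of already-explored nodes and have not yet been explored, one with minimum score is explored (ties broken arbitrarily). The algorithm stops as soon as a node of depth $\delta=n$ is explored; its vertex set is returned as a minimum dominating set. The complexity is the number of explored nodes. -}

module Defs where

open import Data.Bool.Base using (Bool; true; false; if_then_else_)
import Data.Bool.Properties as Boolₚ
open import Data.Fin.Base using (Fin; zero; suc; toℕ; fromℕ<; combine)
import Data.Fin.Properties as Finₚ
open import Data.Fin.Subset using (Subset; inside; outside; ∣_∣; ⊤) renaming (_∈_ to _∈ₛ_)
import Data.Fin.Subset.Properties as Subsetₚ
open import Data.Integer.Base using (+_)
open import Data.List.Base as List using (List; []; _∷_; length; foldr; map; filter; concatMap; cartesianProductWith)
open import Data.List.Membership.Propositional using (_∈_; _∉_; find; lose)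
open import Data.List.Membership.Propositional.Properties using (∈-filter⁺; ∈-filter⁻; ∈-concatMap⁺; ∈-lookup)
open import Data.List.Extrema.Nat using (argmin; argmax; argmin-sel; argmax-sel; f[argmin]≤f[xs]; f[xs]≤f[argmax])
import Data.List.Membership.DecPropositional as DecMembership
open import Data.List.Relation.Unary.All as All using (All; []; _∷_)
open import Data.List.Relation.Unary.Any as Any using (here; there)
open import Data.Nat.Base as ℕ using (ℕ; zero; suc; NonZero; z≤n; s≤s)
import Data.Nat.Properties as ℕₚ
open import Data.Product.Base using (∃; ∃-syntax; _×_; _,_; proj₁; proj₂)
open import Data.Rational.Base as ℚ using (ℚ; 0ℚ; 1ℚ; ½)
import Data.Rational.Properties as ℚₚ
open import Data.Rational.Solver using (module +-*-Solver)
open import Data.Sum.Base using (_⊎_; inj₁; inj₂)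
open import Data.Vec.Base as Vec using (Vec; []; _∷_; lookup; _[_]≔_)
import Data.Vec.Properties as Vecₚ
open import Relation.Binary.Definitions using (DecidableEquality)
open import Relation.Binary.PropositionalEquality using (_≡_; _≢_; refl; sym; trans; cong; subst)
open import Relation.Nullary.Decidable using (Dec; yes; no; _×-dec_; _⊎-dec_; ¬?; map′; recompute)
open import Relation.Nullary.Negation using (contradiction)

------------------------------------------------------------------------
-- Real numbers: Cauchy sequences of rationals.  Any Cauchy sequence is
-- allowed (no fixed modulus), so the ring operations are pointwise.  The
-- equality of reals is x ≤ y and y ≤ x, not the identity of sequences.

IsCauchy : (ℕ → ℚ) → Set
IsCauchy f = ∀ ε → 0ℚ ℚ.< ε →
  ∃[ N ] (∀ i j → N ℕ.≤ i → N ℕ.≤ j → ℚ.∣ f i ℚ.- f j ∣ ℚ.≤ ε)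

record ℝ : Set where
  constructor mkℝ
  field
    seq    : ℕ → ℚ
    cauchy : IsCauchy seq

open ℝ public

private
  open +-*-Solver using (solve; _:+_; _:*_; _:-_; :-_; _:=_)

  ≡⇒≤ : ∀ {p q} → p ≡ q → p ℚ.≤ q
  ≡⇒≤ = ℚₚ.≤-reflexive

  half-pos : ∀ {ε} → 0ℚ ℚ.< ε → 0ℚ ℚ.< ½ ℚ.* ε
  half-pos {ε} 0<ε = ℚₚ.positive⁻¹ (½ ℚ.* ε) {{ℚₚ.pos*pos⇒pos ½ ε {{ℚ.positive 0<ε}}}}

  halves : ∀ ε → ½ ℚ.* ε ℚ.+ ½ ℚ.* ε ≡ ε
  halves ε = trans (sym (ℚₚ.*-distribʳ-+ ε ½ ½)) (ℚₚ.*-identityˡ ε)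

  +-cauchy : ∀ {f g} → IsCauchy f → IsCauchy g → IsCauchy (λ k → f k ℚ.+ g k)
  +-cauchy {f} {g} cf cg ε 0<ε with cf (½ ℚ.* ε) (half-pos 0<ε) | cg (½ ℚ.* ε) (half-pos 0<ε)
  ... | M , hf | N , hg = M ℕ.⊔ N , λ i j hi hj →
    let open ℚₚ.≤-Reasoning in begin
      ℚ.∣ (f i ℚ.+ g i) ℚ.- (f j ℚ.+ g j) ∣
        ≡⟨ cong ℚ.∣_∣ (solve 4 (λ a b c d → (a :+ b) :- (c :+ d) := (a :- c) :+ (b :- d)) refl (f i) (g i) (f j) (g j)) ⟩
      ℚ.∣ (f i ℚ.- f j) ℚ.+ (g i ℚ.- g j) ∣
        ≤⟨ ℚₚ.∣p+q∣≤∣p∣+∣q∣ (f i ℚ.- f j) (g i ℚ.- g j) ⟩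
      ℚ.∣ f i ℚ.- f j ∣ ℚ.+ ℚ.∣ g i ℚ.- g j ∣
        ≤⟨ ℚₚ.+-mono-≤ (hf i j (ℕₚ.m⊔n≤o⇒m≤o M N hi) (ℕₚ.m⊔n≤o⇒m≤o M N hj))
                       (hg i j (ℕₚ.m⊔n≤o⇒n≤o M N hi) (ℕₚ.m⊔n≤o⇒n≤o M N hj)) ⟩
      ½ ℚ.* ε ℚ.+ ½ ℚ.* ε
        ≡⟨ halves ε ⟩
      ε ∎

  neg-cauchy : ∀ {f} → IsCauchy f → IsCauchy (λ k → ℚ.- f k)
  neg-cauchy {f} cf ε 0<ε with cf ε 0<ε
  ... | N , hf = N , λ i j hi hj →
    let open ℚₚ.≤-Reasoning in begin
      ℚ.∣ (ℚ.- f i) ℚ.- (ℚ.- f j) ∣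
        ≡⟨ cong ℚ.∣_∣ (solve 2 (λ a b → (:- a) :- (:- b) := :- (a :- b)) refl (f i) (f j)) ⟩
      ℚ.∣ ℚ.- (f i ℚ.- f j) ∣  ≡⟨ ℚₚ.∣-p∣≡∣p∣ (f i ℚ.- f j) ⟩
      ℚ.∣ f i ℚ.- f j ∣        ≤⟨ hf i j hi hj ⟩
      ε ∎

  0<1 : 0ℚ ℚ.< 1ℚ
  0<1 = ℚₚ.positive⁻¹ 1ℚ

  eventually-bounded : ∀ {f} → IsCauchy f →
    ∃[ B ] (0ℚ ℚ.< B × ∃[ N ] (∀ i → N ℕ.≤ i → ℚ.∣ f i ∣ ℚ.≤ B))
  eventually-bounded {f} cf with cf 1ℚ 0<1
  ... | N , hf = 1ℚ ℚ.+ ℚ.∣ f N ∣ , ℚₚ.+-mono-<-≤ 0<1 (ℚₚ.0≤∣p∣ (f N)) , N , λ i hi →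
    let open ℚₚ.≤-Reasoning in begin
      ℚ.∣ f i ∣
        ≡⟨ cong ℚ.∣_∣ (solve 2 (λ a b → a := (a :- b) :+ b) refl (f i) (f N)) ⟩
      ℚ.∣ (f i ℚ.- f N) ℚ.+ f N ∣
        ≤⟨ ℚₚ.∣p+q∣≤∣p∣+∣q∣ (f i ℚ.- f N) (f N) ⟩
      ℚ.∣ f i ℚ.- f N ∣ ℚ.+ ℚ.∣ f N ∣
        ≤⟨ ℚₚ.+-monoˡ-≤ ℚ.∣ f N ∣ (hf i N hi ℕₚ.≤-refl) ⟩
      1ℚ ℚ.+ ℚ.∣ f N ∣ ∎

  *-mono-∣∣ : ∀ a b {A B} → 0ℚ ℚ.< A → ℚ.∣ a ∣ ℚ.≤ A → ℚ.∣ b ∣ ℚ.≤ B → ℚ.∣ a ℚ.* b ∣ ℚ.≤ A ℚ.* B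
  *-mono-∣∣ a b {A} {B} 0<A a≤A b≤B =
    let open ℚₚ.≤-Reasoning in begin
      ℚ.∣ a ℚ.* b ∣          ≡⟨ ℚₚ.∣p*q∣≡∣p∣*∣q∣ a b ⟩
      ℚ.∣ a ∣ ℚ.* ℚ.∣ b ∣    ≤⟨ ℚₚ.*-monoʳ-≤-nonNeg ℚ.∣ b ∣ {{ℚ.nonNegative (ℚₚ.0≤∣p∣ b)}} a≤A ⟩
      A ℚ.* ℚ.∣ b ∣          ≤⟨ ℚₚ.*-monoˡ-≤-nonNeg A {{ℚ.nonNegative (ℚₚ.<⇒≤ 0<A)}} b≤B ⟩
      A ℚ.* B ∎

  divide : ∀ C ε → 0ℚ ℚ.< C → 0ℚ ℚ.< ε → ∃[ δ ] (0ℚ ℚ.< δ × C ℚ.* δ ≡ ε)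
  divide C ε 0<C 0<ε = C⁻¹ ℚ.* ε , 0<δ , Cδ≡ε
    where
    C>0 = ℚ.positive 0<C
    C≢0 = ℚₚ.pos⇒nonZero C {{C>0}}
    C⁻¹ = ℚ.1/_ C {{C≢0}}
    0<δ : 0ℚ ℚ.< C⁻¹ ℚ.* ε
    0<δ = ℚₚ.positive⁻¹ _ {{ℚₚ.pos*pos⇒pos C⁻¹ {{ℚₚ.1/pos⇒pos C {{C>0}}}} ε {{ℚ.positive 0<ε}}}}
    Cδ≡ε : C ℚ.* (C⁻¹ ℚ.* ε) ≡ ε
    Cδ≡ε = trans (sym (ℚₚ.*-assoc C C⁻¹ ε))
          (trans (cong (ℚ._* ε) (ℚₚ.*-inverseʳ C {{C≢0}})) (ℚₚ.*-identityˡ ε))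

  *-difference : ∀ a b c d → a ℚ.* b ℚ.- c ℚ.* d ≡ a ℚ.* (b ℚ.- d) ℚ.+ d ℚ.* (a ℚ.- c)
  *-difference = solve 4 (λ a b c d → a :* b :- c :* d := a :* (b :- d) :+ d :* (a :- c)) refl

  -- ∣ fᵢgᵢ - fⱼgⱼ ∣ ≤ ∣fᵢ∣ ∣gᵢ - gⱼ∣ + ∣gⱼ∣ ∣fᵢ - fⱼ∣ ≤ (A + B) δ  with  δ = ε / (A + B)
  *-cauchy : ∀ {f g} → IsCauchy f → IsCauchy g → IsCauchy (λ k → f k ℚ.* g k)
  *-cauchy {f} {g} cf cg ε 0<ε =
    combined (eventually-bounded {f} cf) (eventually-bounded {g} cg)
    where
    Bounded : (ℕ → ℚ) → Set
    Bounded h = ∃[ B ] (0ℚ ℚ.< B × ∃[ N ] (∀ i → N ℕ.≤ i → ℚ.∣ h i ∣ ℚ.≤ B))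
    combined : Bounded f → Bounded g →
      ∃[ K ] (∀ i j → K ℕ.≤ i → K ℕ.≤ j → ℚ.∣ f i ℚ.* g i ℚ.- f j ℚ.* g j ∣ ℚ.≤ ε)
    combined (A , 0<A , M₁ , bf) (B , 0<B , N₁ , bg) = M ℕ.⊔ N , λ i j hi hj →
      let Mi = ℕₚ.m⊔n≤o⇒m≤o M N hi ; Mj = ℕₚ.m⊔n≤o⇒m≤o M N hj
          Ni = ℕₚ.m⊔n≤o⇒n≤o M N hi ; Nj = ℕₚ.m⊔n≤o⇒n≤o M N hj
          open ℚₚ.≤-Reasoning in begin
        ℚ.∣ f i ℚ.* g i ℚ.- f j ℚ.* g j ∣
          ≡⟨ cong ℚ.∣_∣ (*-difference (f i) (g i) (f j) (g j)) ⟩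
        ℚ.∣ f i ℚ.* (g i ℚ.- g j) ℚ.+ g j ℚ.* (f i ℚ.- f j) ∣
          ≤⟨ ℚₚ.∣p+q∣≤∣p∣+∣q∣ (f i ℚ.* (g i ℚ.- g j)) (g j ℚ.* (f i ℚ.- f j)) ⟩
        ℚ.∣ f i ℚ.* (g i ℚ.- g j) ∣ ℚ.+ ℚ.∣ g j ℚ.* (f i ℚ.- f j) ∣
          ≤⟨ ℚₚ.+-mono-≤
               (*-mono-∣∣ (f i) (g i ℚ.- g j) 0<A (bf i (ℕₚ.m⊔n≤o⇒m≤o M₁ M₂ Mi))
                 (proj₂ (cg δ 0<δ) i j (ℕₚ.m⊔n≤o⇒n≤o N₁ N₂ Ni) (ℕₚ.m⊔n≤o⇒n≤o N₁ N₂ Nj)))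
               (*-mono-∣∣ (g j) (f i ℚ.- f j) 0<B (bg j (ℕₚ.m⊔n≤o⇒m≤o N₁ N₂ Nj))
                 (proj₂ (cf δ 0<δ) i j (ℕₚ.m⊔n≤o⇒n≤o M₁ M₂ Mi) (ℕₚ.m⊔n≤o⇒n≤o M₁ M₂ Mj))) ⟩
        A ℚ.* δ ℚ.+ B ℚ.* δ
          ≡⟨ Aδ+Bδ≡ε ⟩
        ε ∎
      where
      split = divide (A ℚ.+ B) ε (ℚₚ.+-mono-< 0<A 0<B) 0<ε
      δ = proj₁ split
      0<δ = proj₁ (proj₂ split)
      M₂ = proj₁ (cf δ 0<δ)
      N₂ = proj₁ (cg δ 0<δ)
      M = M₁ ℕ.⊔ M₂
      N = N₁ ℕ.⊔ N₂
      Aδ+Bδ≡ε : A ℚ.* δ ℚ.+ B ℚ.* δ ≡ ε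
      Aδ+Bδ≡ε = trans (sym (ℚₚ.*-distribʳ-+ δ A B)) (proj₂ (proj₂ split))

  const-cauchy : ∀ q → IsCauchy (λ _ → q)
  const-cauchy q ε 0<ε = 0 , λ _ _ _ _ →
    ℚₚ.≤-trans (≡⇒≤ (cong ℚ.∣_∣ (ℚₚ.+-inverseʳ q))) (ℚₚ.<⇒≤ 0<ε)

infixl 6 _+_ _-_
infixl 7 _*_ _/ℕ_
infixr 8 _^_
infix  4 _≤_

fromℚ : ℚ → ℝ
fromℚ q = mkℝ (λ _ → q) (const-cauchy q)

fromℕ : ℕ → ℝ
fromℕ n = fromℚ (+ n ℚ./ 1)

0ℝ 1ℝ 2ℝ : ℝ
0ℝ = fromℕ 0
1ℝ = fromℕ 1
2ℝ = fromℕ 2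

_+_ _-_ _*_ : ℝ → ℝ → ℝ
x + y = mkℝ (λ k → seq x k ℚ.+ seq y k) (+-cauchy {seq x} {seq y} (cauchy x) (cauchy y))
x - y = mkℝ (λ k → seq x k ℚ.+ ℚ.- seq y k) (+-cauchy {seq x} {λ k → ℚ.- seq y k} (cauchy x) (neg-cauchy {seq y} (cauchy y)))
x * y = mkℝ (λ k → seq x k ℚ.* seq y k) (*-cauchy {seq x} {seq y} (cauchy x) (cauchy y))

_^_ : ℝ → ℕ → ℝ
x ^ zero  = 1ℝ
x ^ suc n = x * x ^ n

_/ℕ_ : ℝ → (n : ℕ) → .{{NonZero n}} → ℝ
x /ℕ n = x * fromℚ (+ 1 ℚ./ n)

_≤_ : ℝ → ℝ → Set
x ≤ y = ∀ ε → 0ℚ ℚ.< ε → ∃[ N ] (∀ k → N ℕ.≤ k → seq x k ℚ.≤ seq y k ℚ.+ ε)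

------------------------------------------------------------------------

_⟶∞ : (ℕ → ℝ) → Set
f ⟶∞ = ∀ (K : ℝ) → ∃[ N ] (∀ n → N ℕ.≤ n → K ≤ f n)

-- f(n) = 2^{o(n)} for positive f: for each ε > 0, ∣ log₂ f(n) ∣ ≤ ε n for
-- all large n, that is, f(n) ≤ 2^{εn} and 1 ≤ 2^{εn} f(n).  It is enough to
-- let ε range over the values 1/k; raising to the k-th power then makes
-- all exponents natural numbers.
Is2^o[n] : (ℕ → ℝ) → Set
Is2^o[n] f = ∀ k → .{{NonZero k}} → ∃[ N ] (∀ n → N ℕ.≤ n →
  f n ^ k ≤ 2ℝ ^ n × 1ℝ ≤ 2ℝ ^ n * f n ^ k)

------------------------------------------------------------------------
-- Graphs on the vertex set Fin n, as the strict upper triangle of the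
-- adjacency matrix: the vector in r ∷ G gives the edges between vertex 0
-- and the later vertices.

data Graph : ℕ → Set where
  []  : Graph 0
  _∷_ : ∀ {n} → Vec Bool n → Graph n → Graph (suc n)

adjacent : ∀ {n} → Graph n → Fin n → Fin n → Bool
adjacent (r ∷ G) zero    zero    = false
adjacent (r ∷ G) zero    (suc j) = lookup r j
adjacent (r ∷ G) (suc i) zero    = lookup r i
adjacent (r ∷ G) (suc i) (suc j) = adjacent G i j

Dominating : ∀ {n} → Graph n → Subset n → Set
Dominating G S = ∀ v → v ∈ₛ S ⊎ ∃[ u ] (u ∈ₛ S × adjacent G v u ≡ true)

------------------------------------------------------------------------

allRows : ∀ n → List (Vec Bool n)
allRows zero    = [] ∷ []
allRows (suc n) = cartesianProductWith _∷_ (true ∷ false ∷ []) (allRows n)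

allGraphs : ∀ n → List (Graph n)
allGraphs zero    = [] ∷ []
allGraphs (suc n) = cartesianProductWith _∷_ (allRows n) (allGraphs n)

rowProbability : ∀ {n} → ℝ → Vec Bool n → ℝ
rowProbability p []      = 1ℝ
rowProbability p (b ∷ r) = (if b then p else 1ℝ - p) * rowProbability p r

probability : ∀ {n} → ℝ → Graph n → ℝ
probability p []      = 1ℝ
probability p (r ∷ G) = rowProbability p r * probability p G

expectation : ∀ n → ℝ → (Graph n → ℝ) → ℝ
expectation n p X = foldr _+_ 0ℝ (map (λ G → probability p G * X G) (allGraphs n))

------------------------------------------------------------------------
-- The search tree.  Vertices are numbered from 0, so vertex i has been
-- decided at a node of depth δ exactly when i < δ, and the children of
-- that node decide vertex δ.

record Node (n : ℕ) : Set where
  constructor node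
  field
    chosen     : Subset n
    depth      : ℕ
    .depth≤n   : depth ℕ.≤ n
    .undecided : ∀ i → depth ℕ.≤ toℕ i → lookup chosen i ≡ inside

open Node public using (chosen; depth)

root : ∀ {n} → Node n
root = node ⊤ 0 z≤n (λ i _ → Vecₚ.lookup-replicate i inside)

leftChild : ∀ {n} (ν : Node n) → .(depth ν ℕ.< n) → Node n
leftChild (node x δ _ u) δ<n = node x (suc δ) δ<n (λ i h → u i (ℕₚ.<⇒≤ h))

private
  undecided-remove : ∀ {n} (x : Subset n) δ (δ<n : δ ℕ.< n) →
    (∀ i → δ ℕ.≤ toℕ i → lookup x i ≡ inside) →
    ∀ i → δ ℕ.< toℕ i → lookup (x [ fromℕ< δ<n ]≔ outside) i ≡ inside
  undecided-remove x δ δ<n u i h =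
    trans (Vecₚ.lookup∘update′ i≢δ x outside) (u i (ℕₚ.<⇒≤ h))
    where
    i≢δ : i ≢ fromℕ< δ<n
    i≢δ refl = ℕₚ.<-irrefl (sym (Finₚ.toℕ-fromℕ< δ<n)) h

rightChild : ∀ {n} (ν : Node n) → .(depth ν ℕ.< n) → Node n
rightChild (node x δ _ u) δ<n =
  node (x [ fromℕ< δ<n ]≔ outside) (suc δ) δ<n (undecided-remove x δ δ<n u)

data _ChildOf_ {n} : Node n → Node n → Set where
  left  : ∀ {ν} (δ<n : depth ν ℕ.< n) → leftChild ν δ<n ChildOf ν
  right : ∀ {ν} (δ<n : depth ν ℕ.< n) → rightChild ν δ<n ChildOf ν

Feasible : ∀ {n} → Graph n → Node n → Set
Feasible G ν = Dominating G (chosen ν)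

-- ∣x∣ - n + δ; the truncated subtraction is exact, because the n - δ
-- undecided vertices are chosen.
score : ∀ {n} → Node n → ℕ
score {n} ν = (∣ chosen ν ∣ ℕ.+ depth ν) ℕ.∸ n

------------------------------------------------------------------------
-- The branch-and-bound algorithm.  Ties are broken arbitrarily, so the
-- algorithm is a nondeterministic transition system; its state is the
-- list of explored nodes, the most recent one first.

Candidate : ∀ {n} → Graph n → List (Node n) → Node n → Set
Candidate G explored ν =
  (∃[ μ ] (μ ∈ explored × ν ChildOf μ)) × ν ∉ explored × Feasible G ν

Selectable : ∀ {n} → Graph n → List (Node n) → Node n → Set
Selectable G explored ν =
  Candidate G explored ν × (∀ κ → Candidate G explored κ → score ν ℕ.≤ score κ)

data Trace {n} (G : Graph n) : List (Node n) → Set where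
  start   : Trace G (root ∷ [])
  explore : ∀ {μ μs ν} → Trace G (μ ∷ μs) → depth μ ≢ n →
            Selectable G (μ ∷ μs) ν → Trace G (ν ∷ μ ∷ μs)

record Run {n} (G : Graph n) : Set where
  constructor run
  field
    {final}   : Node n
    {earlier} : List (Node n)
    trace     : Trace G (final ∷ earlier)
    stopped   : depth final ≡ n

  exploredNodes : ℕ
  exploredNodes = length (final ∷ earlier)

open Run public using (exploredNodes)

-- Fixing how all ties are broken amounts to fixing one complete run for
-- every graph; no uniformity between different graphs is required.
TieBreaking : Set
TieBreaking = ∀ {n} (G : Graph n) → Run G

𝕋 : TieBreaking → (n : ℕ) → ℝ → ℝ
𝕋 τ n p = expectation n p (λ G → fromℕ (exploredNodes (τ G)))

------------------------------------------------------------------------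
-- The algorithm terminates without getting stuck, so TieBreaking is
-- inhabited (someTieBreaking) and quantifying over it is not vacuous.

private
  module _ {n : ℕ} where

    node-≡ : ∀ {μ ν : Node n} → chosen μ ≡ chosen ν → depth μ ≡ depth ν → μ ≡ ν
    node-≡ refl refl = refl

    _≟_ : DecidableEquality (Node n)
    μ ≟ ν = map′ (λ (p , q) → node-≡ p q) (λ { refl → refl , refl })
      (Vecₚ.≡-dec Boolₚ._≟_ (chosen μ) (chosen ν) ×-dec (depth μ ℕₚ.≟ depth ν))

    open DecMembership _≟_ using (_∈?_)

    depth≤ : (ν : Node n) → depth ν ℕ.≤ n
    depth≤ (node x δ δ≤n _) = recompute (δ ℕₚ.≤? n) δ≤n

    encodeSubset : ∀ {m} → Subset m → Fin (2 ℕ.^ m)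
    encodeSubset []      = zero
    encodeSubset (b ∷ x) = combine {2} (if b then zero else suc zero) (encodeSubset x)

    encodeSubset-injective : ∀ {m} (x y : Subset m) → encodeSubset x ≡ encodeSubset y → x ≡ y
    encodeSubset-injective []      []      _  = refl
    encodeSubset-injective (b ∷ x) (c ∷ y) eq
      with Finₚ.combine-injective {2} (if b then zero else suc zero) (encodeSubset x) (if c then zero else suc zero) (encodeSubset y) eq
    encodeSubset-injective (true  ∷ x) (true  ∷ y) _ | _  , q = cong (true  ∷_) (encodeSubset-injective x y q)
    encodeSubset-injective (false ∷ x) (false ∷ y) _ | _  , q = cong (false ∷_) (encodeSubset-injective x y q)
    encodeSubset-injective (true  ∷ x) (false ∷ y) _ | () , _
    encodeSubset-injective (false ∷ x) (true  ∷ y) _ | () , _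

    bound : ℕ
    bound = 2 ℕ.^ n ℕ.* suc n

    encode : Node n → Fin bound
    encode ν = combine (encodeSubset (chosen ν)) (fromℕ< (s≤s (depth≤ ν)))

    encode-injective : ∀ {μ ν} → encode μ ≡ encode ν → μ ≡ ν
    encode-injective {μ} {ν} eq
      with Finₚ.combine-injective (encodeSubset (chosen μ)) (fromℕ< (s≤s (depth≤ μ)))
             (encodeSubset (chosen ν)) (fromℕ< (s≤s (depth≤ ν))) eq
    ... | p , q = node-≡ (encodeSubset-injective _ _ p)
                    (Finₚ.fromℕ<-injective _ _ (s≤s (depth≤ μ)) (s≤s (depth≤ ν)) q)

    children : Node n → List (Node n)
    children ν with depth ν ℕₚ.<? n
    ... | yes δ<n = leftChild ν δ<n ∷ rightChild ν δ<n ∷ []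
    ... | no  _   = []

    ∈-children⁺ : ∀ {μ ν} → ν ChildOf μ → ν ∈ children μ
    ∈-children⁺ {μ} (left δ<n) with depth μ ℕₚ.<? n
    ... | yes _ = here refl
    ... | no ¬p = contradiction δ<n ¬p
    ∈-children⁺ {μ} (right δ<n) with depth μ ℕₚ.<? n
    ... | yes _ = there (here refl)
    ... | no ¬p = contradiction δ<n ¬p

    ∈-children⁻ : ∀ {μ ν} → ν ∈ children μ → ν ChildOf μ
    ∈-children⁻ {μ} h with depth μ ℕₚ.<? n
    ∈-children⁻ (here refl)         | yes δ<n = left δ<n
    ∈-children⁻ (there (here refl)) | yes δ<n = right δ<n

    selected : ∀ {κ ν} {νs : List (Node n)} → κ ≡ ν ⊎ κ ∈ νs → ν ∈ νs → κ ∈ νs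
    selected (inj₁ refl) h = h
    selected (inj₂ h)    _ = h

    module _ (G : Graph n) where

      feasible? : ∀ ν → Dec (Feasible G ν)
      feasible? ν = Finₚ.all? λ v → (v Subsetₚ.∈? chosen ν) ⊎-dec
        Finₚ.any? (λ u → (u Subsetₚ.∈? chosen ν) ×-dec (adjacent G v u Boolₚ.≟ true))

      root-feasible : Feasible G root
      root-feasible v = inj₁ Subsetₚ.∈⊤

      left-feasible : ∀ μ .(h : depth μ ℕ.< n) → Feasible G μ → Feasible G (leftChild μ h)
      left-feasible (node _ _ _ _) _ f = f

      left-depth : ∀ (μ : Node n) .(h : depth μ ℕ.< n) → depth (leftChild μ h) ≡ suc (depth μ)
      left-depth (node _ _ _ _) _ = refl

      all-feasible : ∀ {νs} → Trace G νs → All (Feasible G) νs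
      all-feasible start = root-feasible ∷ []
      all-feasible (explore t _ ((_ , _ , f) , _)) = f ∷ all-feasible t

      all-shallow : ∀ {μ μs} → Trace G (μ ∷ μs) → depth μ ≢ n → All (λ ν → depth ν ℕ.< n) (μ ∷ μs)
      all-shallow {μ} start           μ≢n = ℕₚ.≤∧≢⇒< (depth≤ μ) μ≢n ∷ []
      all-shallow {μ} (explore t h _) μ≢n = ℕₚ.≤∧≢⇒< (depth≤ μ) μ≢n ∷ all-shallow t h

      lookup-injective : ∀ {νs} → Trace G νs → ∀ i j → List.lookup νs i ≡ List.lookup νs j → i ≡ j
      lookup-injective start zero zero _ = refl
      lookup-injective (explore t _ _) zero zero _ = refl
      lookup-injective (explore {μ} {μs} t _ ((_ , ν∉ , _) , _)) zero (suc j) eq =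
        contradiction (subst (_∈ (μ ∷ μs)) (sym eq) (∈-lookup j)) ν∉
      lookup-injective (explore {μ} {μs} t _ ((_ , ν∉ , _) , _)) (suc i) zero eq =
        contradiction (subst (_∈ (μ ∷ μs)) eq (∈-lookup i)) ν∉
      lookup-injective (explore t _ _) (suc i) (suc j) eq = cong suc (lookup-injective t i j eq)

      length≤bound : ∀ {νs} → Trace G νs → length νs ℕ.≤ bound
      length≤bound {νs} t = Finₚ.injective⇒≤ {f = λ i → encode (List.lookup νs i)}
        (λ {i} {j} eq → lookup-injective t i j (encode-injective eq))

      candidate : ∀ {μ μs} → Trace G (μ ∷ μs) → depth μ ≢ n → ∃ (Candidate G (μ ∷ μs))
      candidate {μ} {μs} t μ≢n =
        leftChild κ κ<n , (κ , κ∈ , left κ<n) , fresh , left-feasible κ κ<n (All.lookup (all-feasible t) κ∈)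
        where
        κ : Node n
        κ = argmax depth μ (μ ∷ μs)
        κ∈ : κ ∈ μ ∷ μs
        κ∈ = selected (argmax-sel depth μ (μ ∷ μs)) (here refl)
        κ<n : depth κ ℕ.< n
        κ<n = All.lookup (all-shallow t μ≢n) κ∈
        fresh : leftChild κ κ<n ∉ μ ∷ μs
        fresh h = ℕₚ.<-irrefl refl (subst (ℕ._≤ depth κ) (left-depth κ κ<n)
          (All.lookup (f[xs]≤f[argmax] {f = depth} μ (μ ∷ μs)) h))

      selectable : ∀ {μ μs} → Trace G (μ ∷ μs) → depth μ ≢ n → ∃ (Selectable G (μ ∷ μs))
      selectable {μ} {μs} t μ≢n = κ , proj₂ (∈-filter⁻ candidate? {xs = pool} κ∈) , minimal
        where
        es = μ ∷ μs
        child? : ∀ ν → Dec (∃[ κ ] (κ ∈ es × ν ChildOf κ))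
        child? ν = map′
          (λ h → let x , x∈ , p = find h in x , x∈ , ∈-children⁻ p)
          (λ (κ , κ∈ , c) → lose κ∈ (∈-children⁺ c))
          (Any.any? (λ κ → ν ∈? children κ) es)
        candidate? : ∀ ν → Dec (Candidate G es ν)
        candidate? ν = child? ν ×-dec (¬? (ν ∈? es) ×-dec feasible? ν)
        pool = concatMap children es
        ∈-pool : ∀ {ν} → Candidate G es ν → ν ∈ filter candidate? pool
        ∈-pool c@((κ , κ∈ , ch) , _) =
          ∈-filter⁺ candidate? (∈-concatMap⁺ children (lose κ∈ (∈-children⁺ ch))) c
        c₀ = candidate t μ≢n
        κ : Node n
        κ = argmin score (proj₁ c₀) (filter candidate? pool)
        κ∈ : κ ∈ filter candidate? pool
        κ∈ = selected (argmin-sel score (proj₁ c₀) (filter candidate? pool)) (∈-pool (proj₂ c₀))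
        minimal : ∀ ν → Candidate G es ν → score κ ℕ.≤ score ν
        minimal ν c = All.lookup (f[argmin]≤f[xs] {f = score} (proj₁ c₀) (filter candidate? pool)) (∈-pool c)

      continue : ∀ fuel {μ μs} → Trace G (μ ∷ μs) → bound ℕ.< fuel ℕ.+ length (μ ∷ μs) → Run G
      continue zero t h = contradiction (length≤bound t) (ℕₚ.<⇒≱ h)
      continue (suc fuel) {μ} {μs} t h with depth μ ℕₚ.≟ n
      ... | yes eq = run t eq
      ... | no μ≢n = continue fuel (explore t μ≢n (proj₂ (selectable t μ≢n)))
                       (subst (bound ℕ.<_) (sym (ℕₚ.+-suc fuel (length (μ ∷ μs)))) h)

someTieBreaking : TieBreaking
someTieBreaking {n} G = continue G (suc (bound {n})) start (ℕₚ.m≤m+n (suc (bound {n})) 1)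

{-# OPTIONS --safe #-}
module Submission where

-- Every explored node has score at most ∣ D ∣ for every dominating set D: the
-- nodes that agree with D on the decided vertices form a feasible branch of
-- the search tree, and until the run ends this branch contains a candidate.  A
-- node is determined by its depth and its set of kept vertices, whose size is
-- the score, so weighting each node by y^{∣D∣ - score} ≥ 1 bounds the number of
-- explored nodes by (n + 1) (1 + 1/y)^n y^{∣D∣} for every y ≥ 1.
--
-- Let D consist of the last a vertices and of all vertices with no neighbour
-- among them.  The rows of the adjacency matrix are independent, whence
-- 𝔼 [y^{∣D∣}] ≤ y^a (1 + q (y - 1))^n with q = (1 - p)^a ≤ 1 / (1 + a p).
-- If p = c/n with c ≥ 20, then y = 2 and a ≈ n/4 give base < 1.99; if pn → ∞,
-- then y is a large constant and a = n/A for a larger constant A.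

open import Algebra.Bundles using (CommutativeRing)
open import Data.Bool.Base using (Bool; true; false; not; _∧_; _∨_; if_then_else_; T)
import Data.Bool.Properties as Boolₚ
open import Data.Fin.Base using (zero; suc; toℕ; fromℕ<)
open import Data.Fin.Subset using (Subset; inside; outside; ∣_∣; ⊤) renaming (_∈_ to _∈ₛ_)
open import Data.Integer.Base as ℤ using (+_; +≤+)
import Data.Integer.Properties as ℤₚ
open import Data.List.Base using (List; []; _∷_; _++_; length; foldr; map; cartesianProduct; cartesianProductWith; upTo)
import Data.List.Membership.DecPropositional as DecMembership
open import Data.List.Membership.Propositional using (_∈_; _∉_)
open import Data.List.Membership.Propositional.Properties using (∈-∃++; ∈-cartesianProduct⁺; ∈-cartesianProductWith⁺; ∈-upTo⁺; ∈-map⁻)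
open import Data.List.Properties using (length-upTo; map-∘)
open import Data.List.Relation.Unary.All as All using (All; []; _∷_)
import Data.List.Relation.Unary.All.Properties as Allₚ
open import Data.List.Relation.Unary.AllPairs using ([]; _∷_)
open import Data.List.Relation.Unary.Any using (here; there)
open import Data.List.Relation.Unary.Unique.Propositional using (Unique)
import Data.List.Relation.Unary.Unique.Propositional.Properties as Uniqueₚ
open import Data.Nat.Base as ℕ using (ℕ; zero; suc; NonZero; z≤n; s≤s)
open import Data.Nat.DivMod using (m≡m%n+[m/n]*n; m%n<n; m/n*n≤m; /-mono-≤; m≥n⇒m/n>0)
import Data.Nat.Properties as ℕₚ
open import Data.Nat.Solver using () renaming (module +-*-Solver to ℕ-+-*-Solver)
open import Data.Product.Base using (∃-syntax; _×_; _,_; proj₁; proj₂)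
open import Data.Rational.Base as ℚ using (ℚ; 0ℚ; 1ℚ; ½)
import Data.Rational.Properties as ℚₚ
open import Data.Rational.Solver using (module +-*-Solver)
open import Data.Rational.Unnormalised.Base as ℚᵘ using (mkℚᵘ; *≡*; *≤*)
import Data.Rational.Unnormalised.Properties as ℚᵘₚ
open import Data.Sum.Base as Sum using (_⊎_; inj₁; inj₂)
open import Data.Vec.Base as Vec using (Vec; []; _∷_; lookup; _[_]≔_)
import Data.Vec.Properties as Vecₚ
open import Function.Base using (_∘_; const)
open import Relation.Binary.Definitions using (DecidableEquality)
open import Relation.Binary.PropositionalEquality using (_≡_; _≢_; refl; sym; trans; cong; cong₂; subst; subst₂; module ≡-Reasoning)
open import Relation.Nullary.Decidable using (yes; no; from-yes; map′; _×-dec_; recompute)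
open import Relation.Nullary.Negation using (contradiction)
open import Algebra.Properties.CommutativeSemiring.Exp (CommutativeRing.commutativeSemiring ℚₚ.+-*-commutativeRing) using (^-distrib-*; ^-assocʳ; ^-homo-*) renaming (_^_ to _^ℚ_)
open import Defs

open ℕ-+-*-Solver using () renaming (solve to ℕ-solve; con to ℕ-con; _:+_ to _⊞_; _:*_ to _⊠_; _:=_ to _≐_)
open +-*-Solver using (solve; con; _:+_; _:*_; _:-_; :-_; _:=_)

-- Powers of rationals

ι : ℕ → ℚ
ι n = + n ℚ./ 1

-- The fraction `n / 1` is normalised by a gcd that does not reduce for variable `n`, so the
-- identity is checked on unnormalised representatives.
ι-+ : ∀ m n → ι (m ℕ.+ n) ≡ ι m ℚ.+ ι n
ι-+ m n = ℚₚ.toℚᵘ-injective (begin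
  ℚ.toℚᵘ (ι (m ℕ.+ n))                  ≈⟨ ℚₚ.toℚᵘ-fromℚᵘ (mkℚᵘ (+ (m ℕ.+ n)) 0) ⟩
  mkℚᵘ (+ (m ℕ.+ n)) 0                  ≈⟨ *≡* (cong (ℤ._* + 1) (sym (cong₂ ℤ._+_ (ℤₚ.*-identityʳ (+ m)) (ℤₚ.*-identityʳ (+ n))))) ⟩
  mkℚᵘ (+ m) 0 ℚᵘ.+ mkℚᵘ (+ n) 0        ≈⟨ ℚᵘₚ.+-cong (ℚₚ.toℚᵘ-fromℚᵘ (mkℚᵘ (+ m) 0)) (ℚₚ.toℚᵘ-fromℚᵘ (mkℚᵘ (+ n) 0)) ⟨
  ℚ.toℚᵘ (ι m) ℚᵘ.+ ℚ.toℚᵘ (ι n)        ≈⟨ ℚₚ.toℚᵘ-homo-+ (ι m) (ι n) ⟨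
  ℚ.toℚᵘ (ι m ℚ.+ ι n)                  ∎)
  where open ℚᵘₚ.≃-Reasoning

ι-* : ∀ m n → ι (m ℕ.* n) ≡ ι m ℚ.* ι n
ι-* zero    n = sym (ℚₚ.*-zeroˡ (ι n))
ι-* (suc m) n = begin
  ι (n ℕ.+ m ℕ.* n)            ≡⟨ ι-+ n (m ℕ.* n) ⟩
  ι n ℚ.+ ι (m ℕ.* n)          ≡⟨ cong (ι n ℚ.+_) (ι-* m n) ⟩
  ι n ℚ.+ ι m ℚ.* ι n          ≡⟨ solve 2 (λ a b → b :+ a :* b := (con 1ℚ :+ a) :* b) refl (ι m) (ι n) ⟩
  (1ℚ ℚ.+ ι m) ℚ.* ι n         ≡⟨ cong (ℚ._* ι n) (ι-+ 1 m) ⟨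
  ι (suc m) ℚ.* ι n            ∎
  where open ≡-Reasoning

0≤ι : ∀ n → 0ℚ ℚ.≤ ι n
0≤ι n = ℚₚ.nonNegative⁻¹ (ι n) {{ℚₚ.normalize-nonNeg n 1}}

ι-mono : ∀ {m n} → m ℕ.≤ n → ι m ℚ.≤ ι n
ι-mono {m} {n} m≤n = begin
  ι m                   ≡⟨ ℚₚ.+-identityʳ (ι m) ⟨
  ι m ℚ.+ 0ℚ            ≤⟨ ℚₚ.+-monoʳ-≤ (ι m) (0≤ι (n ℕ.∸ m)) ⟩
  ι m ℚ.+ ι (n ℕ.∸ m)   ≡⟨ ι-+ m (n ℕ.∸ m) ⟨
  ι (m ℕ.+ (n ℕ.∸ m))   ≡⟨ cong ι (ℕₚ.m+[n∸m]≡n m≤n) ⟩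
  ι n                   ∎
  where open ℚₚ.≤-Reasoning

inv : (n : ℕ) → .{{NonZero n}} → ℚ
inv n = + 1 ℚ./ n

ι*inv : ∀ n .{{_ : NonZero n}} → ι n ℚ.* inv n ≡ 1ℚ
ι*inv n@(suc m) = ℚₚ.toℚᵘ-injective (begin
  ℚ.toℚᵘ (ι n ℚ.* inv n)                ≈⟨ ℚₚ.toℚᵘ-homo-* (ι n) (inv n) ⟩
  ℚ.toℚᵘ (ι n) ℚᵘ.* ℚ.toℚᵘ (inv n)      ≈⟨ ℚᵘₚ.*-cong (ℚₚ.toℚᵘ-fromℚᵘ (mkℚᵘ (+ n) 0)) (ℚₚ.toℚᵘ-fromℚᵘ (mkℚᵘ (+ 1) m)) ⟩
  mkℚᵘ (+ n) 0 ℚᵘ.* mkℚᵘ (+ 1) m        ≈⟨ *≡* (trans (ℤₚ.*-identityʳ _) (trans (ℤₚ.*-comm (+ n) (+ 1)) (cong (λ i → + 1 ℤ.* + i) (sym (ℕₚ.*-identityˡ n))))) ⟩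
  ℚ.toℚᵘ 1ℚ                             ∎)
  where open ℚᵘₚ.≃-Reasoning

0≤inv : ∀ n .{{_ : NonZero n}} → 0ℚ ℚ.≤ inv n
0≤inv n = ℚₚ.nonNegative⁻¹ (inv n) {{ℚₚ.normalize-nonNeg 1 n}}

*-mono : ∀ {a b c d} → 0ℚ ℚ.≤ a → 0ℚ ℚ.≤ c → a ℚ.≤ b → c ℚ.≤ d → a ℚ.* c ℚ.≤ b ℚ.* d
*-mono {a} {b} {c} {d} 0≤a 0≤c a≤b c≤d = ℚₚ.≤-trans
  (ℚₚ.*-monoʳ-≤-nonNeg c {{ℚ.nonNegative 0≤c}} a≤b)
  (ℚₚ.*-monoˡ-≤-nonNeg b {{ℚ.nonNegative (ℚₚ.≤-trans 0≤a a≤b)}} c≤d)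

*-monoˡ : ∀ {a b c} → 0ℚ ℚ.≤ a → b ℚ.≤ c → a ℚ.* b ℚ.≤ a ℚ.* c
*-monoˡ {a} 0≤a = ℚₚ.*-monoˡ-≤-nonNeg a {{ℚ.nonNegative 0≤a}}

*-monoʳ : ∀ {a b c} → 0ℚ ℚ.≤ a → b ℚ.≤ c → b ℚ.* a ℚ.≤ c ℚ.* a
*-monoʳ {a} 0≤a = ℚₚ.*-monoʳ-≤-nonNeg a {{ℚ.nonNegative 0≤a}}

0≤* : ∀ {a b} → 0ℚ ℚ.≤ a → 0ℚ ℚ.≤ b → 0ℚ ℚ.≤ a ℚ.* b
0≤* {a} {b} 0≤a 0≤b = subst (ℚ._≤ a ℚ.* b) (ℚₚ.*-zeroˡ 0ℚ) (*-mono ℚₚ.≤-refl ℚₚ.≤-refl 0≤a 0≤b)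

0≤+ : ∀ {a b} → 0ℚ ℚ.≤ a → 0ℚ ℚ.≤ b → 0ℚ ℚ.≤ a ℚ.+ b
0≤+ = ℚₚ.+-mono-≤

0≤1 : 0ℚ ℚ.≤ 1ℚ
0≤1 = ℚₚ.nonNegative⁻¹ 1ℚ

a≤a+b : ∀ {a b} → 0ℚ ℚ.≤ b → a ℚ.≤ a ℚ.+ b
a≤a+b {a} {b} 0≤b = subst (ℚ._≤ a ℚ.+ b) (ℚₚ.+-identityʳ a) (ℚₚ.+-monoʳ-≤ a 0≤b)

0≤b-a : ∀ {a b} → a ℚ.≤ b → 0ℚ ℚ.≤ b ℚ.- a
0≤b-a {a} {b} a≤b = subst (ℚ._≤ b ℚ.- a) (ℚₚ.+-inverseʳ a) (ℚₚ.+-monoˡ-≤ (ℚ.- a) a≤b)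

0≤square : ∀ a → 0ℚ ℚ.≤ a ℚ.* a
0≤square a with ℚₚ.≤-total 0ℚ a
... | inj₁ 0≤a = 0≤* 0≤a 0≤a
... | inj₂ a≤0 = subst (0ℚ ℚ.≤_) (solve 1 (λ a → (con 0ℚ :- a) :* (con 0ℚ :- a) := a :* a) refl a)
                   (0≤* (0≤b-a a≤0) (0≤b-a a≤0))

0≤^ : ∀ {a} n → 0ℚ ℚ.≤ a → 0ℚ ℚ.≤ a ^ℚ n
0≤^ zero    0≤a = 0≤1
0≤^ (suc n) 0≤a = 0≤* 0≤a (0≤^ n 0≤a)

^-mono : ∀ {a b} n → 0ℚ ℚ.≤ a → a ℚ.≤ b → a ^ℚ n ℚ.≤ b ^ℚ n
^-mono zero    0≤a a≤b = ℚₚ.≤-refl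
^-mono (suc n) 0≤a a≤b = *-mono 0≤a (0≤^ n 0≤a) a≤b (^-mono n 0≤a a≤b)

1^ : ∀ n → 1ℚ ^ℚ n ≡ 1ℚ
1^ zero    = refl
1^ (suc n) = trans (ℚₚ.*-identityˡ _) (1^ n)

1≤^ : ∀ {a} n → 1ℚ ℚ.≤ a → 1ℚ ℚ.≤ a ^ℚ n
1≤^ {a} n 1≤a = subst (ℚ._≤ a ^ℚ n) (1^ n) (^-mono n 0≤1 1≤a)

^≤1 : ∀ {a} n → 0ℚ ℚ.≤ a → a ℚ.≤ 1ℚ → a ^ℚ n ℚ.≤ 1ℚ
^≤1 {a} n 0≤a a≤1 = subst (a ^ℚ n ℚ.≤_) (1^ n) (^-mono n 0≤a a≤1)

^-monoʳ : ∀ {a m n} → 1ℚ ℚ.≤ a → m ℕ.≤ n → a ^ℚ m ℚ.≤ a ^ℚ n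
^-monoʳ {a} {m} {n} 1≤a m≤n = begin
  a ^ℚ m                         ≡⟨ ℚₚ.*-identityʳ _ ⟨
  a ^ℚ m ℚ.* 1ℚ                  ≤⟨ *-monoˡ (0≤^ m (ℚₚ.≤-trans 0≤1 1≤a)) (1≤^ (n ℕ.∸ m) 1≤a) ⟩
  a ^ℚ m ℚ.* a ^ℚ (n ℕ.∸ m)      ≡⟨ ^-homo-* a m (n ℕ.∸ m) ⟨
  a ^ℚ (m ℕ.+ (n ℕ.∸ m))         ≡⟨ cong (a ^ℚ_) (ℕₚ.m+[n∸m]≡n m≤n) ⟩
  a ^ℚ n                         ∎
  where open ℚₚ.≤-Reasoning

ι-^ : ∀ m n → ι (m ℕ.^ n) ≡ ι m ^ℚ n
ι-^ m zero    = refl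
ι-^ m (suc n) = trans (ι-* m (m ℕ.^ n)) (cong (ι m ℚ.*_) (ι-^ m n))

-- Bernoulli's inequality; the induction step drops the term `n d²`. The range `d ≥ -1` includes
-- negative `d`, and both signs are used below.
bernoulli : ∀ {d} n → 0ℚ ℚ.≤ 1ℚ ℚ.+ d → 1ℚ ℚ.+ ι n ℚ.* d ℚ.≤ (1ℚ ℚ.+ d) ^ℚ n
bernoulli {d} zero    _ = ℚₚ.≤-reflexive (trans (cong (1ℚ ℚ.+_) (ℚₚ.*-zeroˡ d)) (ℚₚ.+-identityʳ 1ℚ))
bernoulli {d} (suc n) h = begin
  1ℚ ℚ.+ ι (suc n) ℚ.* d
    ≡⟨ cong (λ t → 1ℚ ℚ.+ t ℚ.* d) (ι-+ 1 n) ⟩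
  1ℚ ℚ.+ (1ℚ ℚ.+ ι n) ℚ.* d
    ≤⟨ a≤a+b (0≤* (0≤ι n) (0≤square d)) ⟩
  1ℚ ℚ.+ (1ℚ ℚ.+ ι n) ℚ.* d ℚ.+ ι n ℚ.* (d ℚ.* d)
    ≡⟨ solve 2 (λ m d → con 1ℚ :+ (con 1ℚ :+ m) :* d :+ m :* (d :* d) := (con 1ℚ :+ d) :* (con 1ℚ :+ m :* d)) refl (ι n) d ⟩
  (1ℚ ℚ.+ d) ℚ.* (1ℚ ℚ.+ ι n ℚ.* d)
    ≤⟨ *-monoˡ h (bernoulli n h) ⟩
  (1ℚ ℚ.+ d) ℚ.* (1ℚ ℚ.+ d) ^ℚ n ∎
  where open ℚₚ.≤-Reasoning

-- `(1 - x)(1 + x) = 1 - x²` lies in `[0, 1]`, and so do its powers. Bounding one factor from below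
-- by Bernoulli's inequality gives the next two lemmas.
[1-x]^n*[1+x]^n≤1 : ∀ {x} n → 0ℚ ℚ.≤ x → x ℚ.≤ 1ℚ →
  (1ℚ ℚ.- x) ^ℚ n ℚ.* (1ℚ ℚ.+ x) ^ℚ n ℚ.≤ 1ℚ
[1-x]^n*[1+x]^n≤1 {x} n 0≤x x≤1 = subst (ℚ._≤ 1ℚ) (^-distrib-* (1ℚ ℚ.- x) (1ℚ ℚ.+ x) n)
  (^≤1 n (0≤* (0≤b-a x≤1) (0≤+ 0≤1 0≤x)) (begin
    (1ℚ ℚ.- x) ℚ.* (1ℚ ℚ.+ x)                ≤⟨ a≤a+b (0≤square x) ⟩
    (1ℚ ℚ.- x) ℚ.* (1ℚ ℚ.+ x) ℚ.+ x ℚ.* x    ≡⟨ solve 1 (λ x → (con 1ℚ :- x) :* (con 1ℚ :+ x) :+ x :* x := con 1ℚ) refl x ⟩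
    1ℚ                                       ∎))
  where open ℚₚ.≤-Reasoning

-- Division-free form of `(1 - p)^n ≤ 1 / (1 + n p)`, which bounds the probability that a vertex has
-- no neighbour among `n` given ones.
[1-p]^n*[1+np]≤1 : ∀ {p} n → 0ℚ ℚ.≤ p → p ℚ.≤ 1ℚ →
  (1ℚ ℚ.- p) ^ℚ n ℚ.* (1ℚ ℚ.+ ι n ℚ.* p) ℚ.≤ 1ℚ
[1-p]^n*[1+np]≤1 n 0≤p p≤1 = ℚₚ.≤-trans
  (*-monoˡ (0≤^ n (0≤b-a p≤1)) (bernoulli n (0≤+ 0≤1 0≤p)))
  ([1-x]^n*[1+x]^n≤1 n 0≤p p≤1)

[1+x]^n*[1-nx]≤1 : ∀ {x} n → 0ℚ ℚ.≤ x → x ℚ.≤ 1ℚ →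
  (1ℚ ℚ.+ x) ^ℚ n ℚ.* (1ℚ ℚ.- ι n ℚ.* x) ℚ.≤ 1ℚ
[1+x]^n*[1-nx]≤1 {x} n 0≤x x≤1 = ℚₚ.≤-trans
  (*-monoˡ (0≤^ n (0≤+ 0≤1 0≤x)) (subst (λ t → 1ℚ ℚ.+ t ℚ.≤ (1ℚ ℚ.- x) ^ℚ n) (sym (ℚₚ.neg-distribʳ-* (ι n) x)) (bernoulli n (0≤b-a x≤1))))
  (subst (ℚ._≤ 1ℚ) (ℚₚ.*-comm ((1ℚ ℚ.- x) ^ℚ n) ((1ℚ ℚ.+ x) ^ℚ n)) ([1-x]^n*[1+x]^n≤1 n 0≤x x≤1))

-- From `n` to `n + 1` the left side grows by `(2 n + 1) d² ≤ 2 d (1 + n d)`, as `d ≤ 1`, and the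
-- right side by `2 d (1 + d)^n`, which is at least as much by Bernoulli's inequality.
quadratic-growth : ∀ {d} n → 0ℚ ℚ.≤ d → d ℚ.≤ 1ℚ →
  ι n ℚ.* ι n ℚ.* (d ℚ.* d) ℚ.≤ ι 2 ℚ.* (1ℚ ℚ.+ d) ^ℚ n
quadratic-growth {d} zero    0≤d d≤1 = begin
  ι 0 ℚ.* ι 0 ℚ.* (d ℚ.* d)     ≡⟨ ℚₚ.*-zeroˡ (d ℚ.* d) ⟩
  0ℚ                            ≤⟨ 0≤ι 2 ⟩
  ι 2 ℚ.* (1ℚ ℚ.+ d) ^ℚ zero    ∎
  where open ℚₚ.≤-Reasoning
quadratic-growth {d} (suc n) 0≤d d≤1 = begin
  ι (suc n) ℚ.* ι (suc n) ℚ.* (d ℚ.* d)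
    ≡⟨ cong (λ t → t ℚ.* t ℚ.* (d ℚ.* d)) (ι-+ 1 n) ⟩
  (1ℚ ℚ.+ ι n) ℚ.* (1ℚ ℚ.+ ι n) ℚ.* (d ℚ.* d)
    ≤⟨ a≤a+b (0≤* 0≤d (0≤+ 0≤1 (0≤b-a d≤1))) ⟩
  (1ℚ ℚ.+ ι n) ℚ.* (1ℚ ℚ.+ ι n) ℚ.* (d ℚ.* d) ℚ.+ d ℚ.* (1ℚ ℚ.+ (1ℚ ℚ.- d))
    ≡⟨ solve 2 (λ m d → (con 1ℚ :+ m) :* (con 1ℚ :+ m) :* (d :* d) :+ d :* (con 1ℚ :+ (con 1ℚ :- d))
         := m :* m :* (d :* d) :+ con (ι 2) :* d :* (con 1ℚ :+ m :* d)) refl (ι n) d ⟩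
  ι n ℚ.* ι n ℚ.* (d ℚ.* d) ℚ.+ ι 2 ℚ.* d ℚ.* (1ℚ ℚ.+ ι n ℚ.* d)
    ≤⟨ ℚₚ.+-mono-≤ (quadratic-growth n 0≤d d≤1) (*-monoˡ (0≤* (0≤ι 2) 0≤d) (bernoulli n (0≤+ 0≤1 0≤d))) ⟩
  ι 2 ℚ.* (1ℚ ℚ.+ d) ^ℚ n ℚ.+ ι 2 ℚ.* d ℚ.* (1ℚ ℚ.+ d) ^ℚ n
    ≡⟨ solve 2 (λ d t → con (ι 2) :* t :+ con (ι 2) :* d :* t := con (ι 2) :* ((con 1ℚ :+ d) :* t)) refl d ((1ℚ ℚ.+ d) ^ℚ n) ⟩
  ι 2 ℚ.* ((1ℚ ℚ.+ d) ℚ.* (1ℚ ℚ.+ d) ^ℚ n) ∎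
  where open ℚₚ.≤-Reasoning

inv≤1 : ∀ n .{{_ : NonZero n}} → inv n ℚ.≤ 1ℚ
inv≤1 n@(suc m) = begin
  inv n               ≡⟨ ℚₚ.*-identityˡ (inv n) ⟨
  1ℚ ℚ.* inv n        ≤⟨ *-monoʳ (0≤inv n) (ι-mono {1} {n} (s≤s z≤n)) ⟩
  ι n ℚ.* inv n       ≡⟨ ι*inv n ⟩
  1ℚ                  ∎
  where open ℚₚ.≤-Reasoning

2[1+n]M²≤n² : ∀ M .{{_ : NonZero M}} n → 4 ℕ.* (M ℕ.* M) ℕ.≤ n →
  2 ℕ.* suc n ℕ.* (M ℕ.* M) ℕ.≤ n ℕ.* n
2[1+n]M²≤n² M n h = begin
  2 ℕ.* suc n ℕ.* (M ℕ.* M)      ≤⟨ ℕₚ.*-monoˡ-≤ (M ℕ.* M) (ℕₚ.*-monoʳ-≤ 2 (ℕₚ.+-monoˡ-≤ n 1≤n)) ⟩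
  2 ℕ.* (n ℕ.+ n) ℕ.* (M ℕ.* M)  ≡⟨ ℕ-solve 2 (λ n m → ℕ-con 2 ⊠ (n ⊞ n) ⊠ m ≐ n ⊠ (ℕ-con 4 ⊠ m)) refl n (M ℕ.* M) ⟩
  n ℕ.* (4 ℕ.* (M ℕ.* M))        ≤⟨ ℕₚ.*-monoʳ-≤ n h ⟩
  n ℕ.* n                        ∎
  where
  open ℕₚ.≤-Reasoning
  1≤n : 1 ℕ.≤ n
  1≤n = ℕₚ.≤-trans (ℕ.>-nonZero⁻¹ _ {{ℕₚ.m*n≢0 4 (M ℕ.* M) {{_}} {{ℕₚ.m*n≢0 M M}}}}) h

-- Absorbs the factor `n + 1`, which counts depths, into an exponential with base as close to 1 as
-- desired. Quadratic growth with `d = 1/M` suffices, because `2 (n + 1) M² ≤ n²` once `n ≥ 4 M²`.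
linear≤exponential : ∀ M .{{_ : NonZero M}} n → 4 ℕ.* (M ℕ.* M) ℕ.≤ n →
  ι (suc n) ℚ.≤ (1ℚ ℚ.+ inv M) ^ℚ n
linear≤exponential M n h = ℚₚ.*-cancelˡ-≤-pos (ι 2) (begin
  ι 2 ℚ.* ι (suc n)
    ≡⟨ ι-* 2 (suc n) ⟨
  ι (2 ℕ.* suc n)
    ≡⟨ ℚₚ.*-identityʳ _ ⟨
  ι (2 ℕ.* suc n) ℚ.* (1ℚ ℚ.* 1ℚ)
    ≡⟨ cong (λ t → ι (2 ℕ.* suc n) ℚ.* (t ℚ.* t)) (ι*inv M) ⟨
  ι (2 ℕ.* suc n) ℚ.* (ι M ℚ.* d ℚ.* (ι M ℚ.* d))
    ≡⟨ solve 3 (λ a b c → a :* (b :* c :* (b :* c)) := (a :* (b :* b)) :* (c :* c)) refl (ι (2 ℕ.* suc n)) (ι M) d ⟩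
  ι (2 ℕ.* suc n) ℚ.* (ι M ℚ.* ι M) ℚ.* (d ℚ.* d)
    ≡⟨ cong (ℚ._* (d ℚ.* d)) (trans (ι-* (2 ℕ.* suc n) (M ℕ.* M)) (cong (ι (2 ℕ.* suc n) ℚ.*_) (ι-* M M))) ⟨
  ι (2 ℕ.* suc n ℕ.* (M ℕ.* M)) ℚ.* (d ℚ.* d)
    ≤⟨ *-monoʳ (0≤square d) (ι-mono (2[1+n]M²≤n² M n h)) ⟩
  ι (n ℕ.* n) ℚ.* (d ℚ.* d)
    ≡⟨ cong (ℚ._* (d ℚ.* d)) (ι-* n n) ⟩
  ι n ℚ.* ι n ℚ.* (d ℚ.* d)
    ≤⟨ quadratic-growth n (0≤inv M) (inv≤1 M) ⟩
  ι 2 ℚ.* (1ℚ ℚ.+ d) ^ℚ n ∎)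
  where
  open ℚₚ.≤-Reasoning
  d = inv M

-- Finite sums and expectations

Σℚ : ∀ {A : Set} → (A → ℚ) → List A → ℚ
Σℚ f xs = foldr ℚ._+_ 0ℚ (map f xs)

module _ {A : Set} where

  Σ-cong : ∀ {f g : A → ℚ} → (∀ x → f x ≡ g x) → ∀ xs → Σℚ f xs ≡ Σℚ g xs
  Σ-cong h []       = refl
  Σ-cong h (x ∷ xs) = cong₂ ℚ._+_ (h x) (Σ-cong h xs)

  Σ-mono : ∀ {f g : A → ℚ} {xs} → All (λ x → f x ℚ.≤ g x) xs → Σℚ f xs ℚ.≤ Σℚ g xs
  Σ-mono []       = ℚₚ.≤-refl
  Σ-mono (h ∷ hs) = ℚₚ.+-mono-≤ h (Σ-mono hs)

  Σ-*ˡ : ∀ c (f : A → ℚ) xs → Σℚ (λ x → c ℚ.* f x) xs ≡ c ℚ.* Σℚ f xs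
  Σ-*ˡ c f []       = sym (ℚₚ.*-zeroʳ c)
  Σ-*ˡ c f (x ∷ xs) = trans (cong (c ℚ.* f x ℚ.+_) (Σ-*ˡ c f xs)) (sym (ℚₚ.*-distribˡ-+ c (f x) _))

  Σ-+ : ∀ (f g : A → ℚ) xs → Σℚ (λ x → f x ℚ.+ g x) xs ≡ Σℚ f xs ℚ.+ Σℚ g xs
  Σ-+ f g []       = refl
  Σ-+ f g (x ∷ xs) = trans (cong (f x ℚ.+ g x ℚ.+_) (Σ-+ f g xs))
    (solve 4 (λ a b c d → a :+ b :+ (c :+ d) := (a :+ c) :+ (b :+ d)) refl (f x) (g x) _ _)

  Σ-++ : ∀ (f : A → ℚ) xs ys → Σℚ f (xs ++ ys) ≡ Σℚ f xs ℚ.+ Σℚ f ys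
  Σ-++ f []       ys = sym (ℚₚ.+-identityˡ _)
  Σ-++ f (x ∷ xs) ys = trans (cong (f x ℚ.+_) (Σ-++ f xs ys)) (sym (ℚₚ.+-assoc (f x) _ _))

  Σ-1 : ∀ (xs : List A) → Σℚ (const 1ℚ) xs ≡ ι (length xs)
  Σ-1 []       = refl
  Σ-1 (x ∷ xs) = trans (cong (1ℚ ℚ.+_) (Σ-1 xs)) (sym (ι-+ 1 (length xs)))

  Σ-nonneg : ∀ {f : A → ℚ} → (∀ x → 0ℚ ℚ.≤ f x) → ∀ xs → 0ℚ ℚ.≤ Σℚ f xs
  Σ-nonneg h []       = ℚₚ.≤-refl
  Σ-nonneg h (x ∷ xs) = 0≤+ (h x) (Σ-nonneg h xs)

  -- Each element of `xs` is matched with an occurrence in `ys`, which is then deleted. Since `xs`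
  -- has no repetitions, its remaining elements survive the deletion; what is left of `ys` at the
  -- end has nonnegative sum.
  Σ-⊆ : ∀ {f : A → ℚ} → (∀ x → 0ℚ ℚ.≤ f x) → ∀ {xs ys} → Unique xs →
    (∀ {x} → x ∈ xs → x ∈ ys) → Σℚ f xs ℚ.≤ Σℚ f ys
  Σ-⊆ h {[]}     {ys} _          _  = Σ-nonneg h ys
  Σ-⊆ {f} h {x ∷ xs} {ys} (x∉ ∷ uniq) xs⊆ys with ∈-∃++ (xs⊆ys (here refl))
  ... | as , bs , refl = begin
    f x ℚ.+ Σℚ f xs                 ≤⟨ ℚₚ.+-monoʳ-≤ (f x) (Σ-⊆ h uniq xs⊆as++bs) ⟩
    f x ℚ.+ Σℚ f (as ++ bs)         ≡⟨ cong (f x ℚ.+_) (Σ-++ f as bs) ⟩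
    f x ℚ.+ (Σℚ f as ℚ.+ Σℚ f bs)   ≡⟨ solve 3 (λ a b c → a :+ (b :+ c) := b :+ (a :+ c)) refl (f x) (Σℚ f as) (Σℚ f bs) ⟩
    Σℚ f as ℚ.+ (f x ℚ.+ Σℚ f bs)   ≡⟨ Σ-++ f as (x ∷ bs) ⟨
    Σℚ f (as ++ x ∷ bs)             ∎
    where
    open ℚₚ.≤-Reasoning
    delete : ∀ {z} as → z ∈ as ++ x ∷ bs → x ≢ z → z ∈ as ++ bs
    delete []       (here refl) x≢z = contradiction refl x≢z
    delete []       (there z∈)  _   = z∈
    delete (_ ∷ as) (here refl) _   = here refl
    delete (_ ∷ as) (there z∈)  x≢z = there (delete as z∈ x≢z)
    xs⊆as++bs : ∀ {z} → z ∈ xs → z ∈ as ++ bs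
    xs⊆as++bs z∈ = delete as (xs⊆ys (there z∈)) (All.lookup x∉ z∈)

-- Distributivity. With probabilities as weights, this is how the independence of rows and of single
-- edges is used.
Σ-product : ∀ {A B C : Set} {g : A → B → C} {f : C → ℚ} (u : A → ℚ) (v : B → ℚ) →
  (∀ x y → f (g x y) ≡ u x ℚ.* v y) → ∀ xs ys →
  Σℚ f (cartesianProductWith g xs ys) ≡ Σℚ u xs ℚ.* Σℚ v ys
Σ-product u v h [] ys = sym (ℚₚ.*-zeroˡ (Σℚ v ys))
Σ-product {g = g} {f} u v h (x ∷ xs) ys = trans (Σ-++ f (map (g x) ys) (cartesianProductWith g xs ys))
  (trans (cong₂ ℚ._+_ (slice ys) (Σ-product u v h xs ys)) (sym (ℚₚ.*-distribʳ-+ (Σℚ v ys) (u x) (Σℚ u xs))))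
  where
  slice : ∀ ys → Σℚ f (map (g x) ys) ≡ u x ℚ.* Σℚ v ys
  slice []       = sym (ℚₚ.*-zeroʳ (u x))
  slice (y ∷ ys) = trans (cong₂ ℚ._+_ (h x y) (slice ys)) (sym (ℚₚ.*-distribˡ-+ (u x) (v y) _))

Σ-rows : ∀ n (f : Vec Bool (suc n) → ℚ) (u : Bool → ℚ) (v : Vec Bool n → ℚ) →
  (∀ b r → f (b ∷ r) ≡ u b ℚ.* v r) →
  Σℚ f (allRows (suc n)) ≡ (u true ℚ.+ u false) ℚ.* Σℚ v (allRows n)
Σ-rows n f u v h = trans (Σ-product u v h (true ∷ false ∷ []) (allRows n))
  (cong (λ t → (u true ℚ.+ t) ℚ.* Σℚ v (allRows n)) (ℚₚ.+-identityʳ (u false)))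

bitProb : ℚ → Bool → ℚ
bitProb p b = if b then p else 1ℚ ℚ.- p

rowProb : ∀ {n} → ℚ → Vec Bool n → ℚ
rowProb p []      = 1ℚ
rowProb p (b ∷ r) = bitProb p b ℚ.* rowProb p r

prob : ∀ {n} → ℚ → Graph n → ℚ
prob p []      = 1ℚ
prob p (r ∷ G) = rowProb p r ℚ.* prob p G

𝔼 : ∀ n → ℚ → (Graph n → ℚ) → ℚ
𝔼 n p X = Σℚ (λ G → prob p G ℚ.* X G) (allGraphs n)

-- Real operations act termwise, so each term of a real probability is the rational probability at
-- the same term of `p`. The estimates can thus be made over the rationals.
seq-rowProbability : ∀ {n} p (r : Vec Bool n) k → seq (rowProbability p r) k ≡ rowProb (seq p k) r
seq-rowProbability p []          k = refl
seq-rowProbability p (true  ∷ r) k = cong (seq p k ℚ.*_) (seq-rowProbability p r k)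
seq-rowProbability p (false ∷ r) k = cong ((1ℚ ℚ.- seq p k) ℚ.*_) (seq-rowProbability p r k)

seq-probability : ∀ {n} p (G : Graph n) k → seq (probability p G) k ≡ prob (seq p k) G
seq-probability p []      k = refl
seq-probability p (r ∷ G) k = cong₂ ℚ._*_ (seq-rowProbability p r k) (seq-probability p G k)

seq-expectation : ∀ n p X k → seq (expectation n p X) k ≡ 𝔼 n (seq p k) (λ G → seq (X G) k)
seq-expectation n p X k = go (allGraphs n)
  where
  go : ∀ Gs → seq (foldr _+_ 0ℝ (map (λ G → probability p G * X G) Gs)) k
            ≡ Σℚ (λ G → prob (seq p k) G ℚ.* seq (X G) k) Gs
  go []       = refl
  go (G ∷ Gs) = cong₂ ℚ._+_ (cong (ℚ._* seq (X G) k) (seq-probability p G k)) (go Gs)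

seq-^ : ∀ x n k → seq (x ^ n) k ≡ seq x k ^ℚ n
seq-^ x zero    k = refl
seq-^ x (suc n) k = cong (seq x k ℚ.*_) (seq-^ x n k)

p+[1-p]≡1 : ∀ p → p ℚ.+ (1ℚ ℚ.- p) ≡ 1ℚ
p+[1-p]≡1 = solve 1 (λ p → p :+ (con 1ℚ :- p) := con 1ℚ) refl

Σ-rowProb : ∀ n p → Σℚ (rowProb p) (allRows n) ≡ 1ℚ
Σ-rowProb zero    p = refl
Σ-rowProb (suc n) p = trans (Σ-rows n (rowProb p) (bitProb p) (rowProb p) (λ _ _ → refl))
  (trans (cong₂ ℚ._*_ (p+[1-p]≡1 p) (Σ-rowProb n p)) (ℚₚ.*-identityˡ 1ℚ))

Σ-prob : ∀ n p → Σℚ (prob p) (allGraphs n) ≡ 1ℚ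
Σ-prob zero    p = refl
Σ-prob (suc n) p = trans (Σ-product (rowProb p) (prob p) (λ _ _ → refl) (allRows n) (allGraphs n))
  (trans (cong₂ ℚ._*_ (Σ-rowProb n p) (Σ-prob n p)) (ℚₚ.*-identityˡ 1ℚ))

module _ {p : ℚ} (0≤p : 0ℚ ℚ.≤ p) (p≤1 : p ℚ.≤ 1ℚ) where

  0≤rowProb : ∀ {n} (r : Vec Bool n) → 0ℚ ℚ.≤ rowProb p r
  0≤rowProb []          = 0≤1
  0≤rowProb (true  ∷ r) = 0≤* 0≤p (0≤rowProb r)
  0≤rowProb (false ∷ r) = 0≤* (0≤b-a p≤1) (0≤rowProb r)

  0≤prob : ∀ {n} (G : Graph n) → 0ℚ ℚ.≤ prob p G
  0≤prob []      = 0≤1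
  0≤prob (r ∷ G) = 0≤* (0≤rowProb r) (0≤prob G)

  𝔼-mono : ∀ {n} {X Y : Graph n → ℚ} → (∀ G → X G ℚ.≤ Y G) → 𝔼 n p X ℚ.≤ 𝔼 n p Y
  𝔼-mono {n} h = Σ-mono (All.universal (λ G → *-monoˡ (0≤prob G) (h G)) (allGraphs n))

𝔼-*ˡ : ∀ n p c X → 𝔼 n p (λ G → c ℚ.* X G) ≡ c ℚ.* 𝔼 n p X
𝔼-*ˡ n p c X = trans
  (Σ-cong (λ G → solve 3 (λ a b c → a :* (b :* c) := b :* (a :* c)) refl (prob p G) c (X G)) (allGraphs n))
  (Σ-*ˡ c (λ G → prob p G ℚ.* X G) (allGraphs n))

𝔼-1 : ∀ n p → 𝔼 n p (const 1ℚ) ≡ 1ℚ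
𝔼-1 n p = trans (Σ-cong (λ G → ℚₚ.*-identityʳ (prob p G)) (allGraphs n)) (Σ-prob n p)

-- The dominating set built from the last vertices and its exponential moment.

noEdgeToLast : ∀ {n} → ℕ → Vec Bool n → Bool
noEdgeToLast         a []      = true
-- An entry followed by `n` others belongs to a vertex with exactly `n` vertices after it, which is
-- among the last `a` precisely when `n < a`.
noEdgeToLast {suc n} a (b ∷ r) = (if n ℕ.<ᵇ a then not b else true) ∧ noEdgeToLast a r

-- The set `D` of the overview. Rows list later vertices only, so taking the last `a` vertices as
-- the core makes membership of each vertex depend on its own row alone.
completion : ∀ {n} → ℕ → Graph n → Subset n
completion         a []      = []
completion {suc n} a (r ∷ G) = ((n ℕ.<ᵇ a) ∨ noEdgeToLast a r) ∷ completion a G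

<ᵇ-true : ∀ {m n} → m ℕ.< n → (m ℕ.<ᵇ n) ≡ true
<ᵇ-true {m} {n} m<n with m ℕ.<ᵇ n | ℕₚ.<⇒<ᵇ m<n
... | true | _ = refl

<ᵇ-true⁻ : ∀ {m n} → (m ℕ.<ᵇ n) ≡ true → m ℕ.< n
<ᵇ-true⁻ {m} {n} eq = ℕₚ.<ᵇ⇒< m n (subst T (sym eq) _)

<ᵇ-false⁻ : ∀ {m n} → (m ℕ.<ᵇ n) ≡ false → n ℕ.≤ m
<ᵇ-false⁻ eq = ℕₚ.≮⇒≥ (λ h → contradiction (trans (sym eq) (<ᵇ-true h)) λ ())

1+[n⊓a] : ∀ {n a} → n ℕ.< a → suc (n ℕ.⊓ a) ≡ suc n ℕ.⊓ a
1+[n⊓a] n<a = trans (cong suc (ℕₚ.m≤n⇒m⊓n≡m (ℕₚ.<⇒≤ n<a))) (sym (ℕₚ.m≤n⇒m⊓n≡m n<a))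

n⊓a≡[1+n]⊓a : ∀ {n a} → a ℕ.≤ n → n ℕ.⊓ a ≡ suc n ℕ.⊓ a
n⊓a≡[1+n]⊓a a≤n = trans (ℕₚ.m≥n⇒m⊓n≡n a≤n) (sym (ℕₚ.m≥n⇒m⊓n≡n (ℕₚ.m≤n⇒m≤1+n a≤n)))

last∈completion : ∀ {n} a (G : Graph n) j → n ℕ.≤ toℕ j ℕ.+ a → lookup (completion a G) j ≡ inside
last∈completion {suc n} a (r ∷ G) zero    h rewrite <ᵇ-true h = refl
last∈completion {suc n} a (r ∷ G) (suc j) (s≤s h) = last∈completion a G j h

edgeToLast : ∀ {n} a (r : Vec Bool n) → noEdgeToLast a r ≡ false →
  ∃[ j ] (n ℕ.≤ toℕ j ℕ.+ a × lookup r j ≡ true)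
edgeToLast {suc n} a (b ∷ r) h with n ℕ.<ᵇ a in eq
edgeToLast {suc n} a (true  ∷ r) h | true  = zero , <ᵇ-true⁻ {n} {a} eq , refl
edgeToLast {suc n} a (false ∷ r) h | true  = let j , n≤ , e = edgeToLast a r h in suc j , s≤s n≤ , e
edgeToLast {suc n} a (b     ∷ r) h | false = let j , n≤ , e = edgeToLast a r h in suc j , s≤s n≤ , e

completion-dominating : ∀ {n} a (G : Graph n) → Dominating G (completion a G)
completion-dominating {suc n} a (r ∷ G) zero with n ℕ.<ᵇ a | noEdgeToLast a r in eq
... | true  | _     = inj₁ Vec.here
... | false | true  = inj₁ Vec.here
... | false | false = let j , n≤ , e = edgeToLast a r eq in
  inj₂ (suc j , Vec.there (Vecₚ.lookup⇒[]= j (completion a G) (last∈completion a G j n≤)) , e)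
completion-dominating {suc n} a (r ∷ G) (suc v) with completion-dominating a G v
... | inj₁ v∈            = inj₁ (Vec.there v∈)
... | inj₂ (u , u∈ , vu) = inj₂ (suc u , Vec.there u∈ , vu)

𝟙 : Bool → ℚ
𝟙 b = if b then 1ℚ else 0ℚ

𝟙-∧ : ∀ b c → 𝟙 (b ∧ c) ≡ 𝟙 b ℚ.* 𝟙 c
𝟙-∧ true  c = sym (ℚₚ.*-identityˡ (𝟙 c))
𝟙-∧ false c = sym (ℚₚ.*-zeroˡ (𝟙 c))

-- Each entry for one of the last `a` vertices must be absent, the others are free. A row with fewer
-- than `a` entries has only `n` such constraints, whence the minimum.
P[noEdgeToLast] : ∀ n a p →
  Σℚ (λ r → rowProb p r ℚ.* 𝟙 (noEdgeToLast a r)) (allRows n) ≡ (1ℚ ℚ.- p) ^ℚ (n ℕ.⊓ a)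
P[noEdgeToLast] zero    a p = refl
P[noEdgeToLast] (suc n) a p = trans
  (Σ-rows n _ (λ b → bitProb p b ℚ.* 𝟙 (admissible b)) (λ r → rowProb p r ℚ.* 𝟙 (noEdgeToLast a r)) factor)
  (trans (cong ((bitProb p true ℚ.* 𝟙 (admissible true) ℚ.+ bitProb p false ℚ.* 𝟙 (admissible false)) ℚ.*_) (P[noEdgeToLast] n a p)) step)
  where
  admissible : Bool → Bool
  admissible b = if n ℕ.<ᵇ a then not b else true
  factor : ∀ b r → rowProb p (b ∷ r) ℚ.* 𝟙 (noEdgeToLast a (b ∷ r)) ≡
    (bitProb p b ℚ.* 𝟙 (admissible b)) ℚ.* (rowProb p r ℚ.* 𝟙 (noEdgeToLast a r))
  factor b r = trans (cong (rowProb p (b ∷ r) ℚ.*_) (𝟙-∧ (admissible b) (noEdgeToLast a r)))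
    (solve 4 (λ x y z w → (x :* y) :* (z :* w) := (x :* z) :* (y :* w)) refl
      (bitProb p b) (rowProb p r) (𝟙 (admissible b)) (𝟙 (noEdgeToLast a r)))
  step : (p ℚ.* 𝟙 (admissible true) ℚ.+ (1ℚ ℚ.- p) ℚ.* 𝟙 (admissible false)) ℚ.* (1ℚ ℚ.- p) ^ℚ (n ℕ.⊓ a)
    ≡ (1ℚ ℚ.- p) ^ℚ (suc n ℕ.⊓ a)
  step with n ℕ.<ᵇ a in eq
  ... | true = trans (solve 2 (λ p t → (p :* con 0ℚ :+ (con 1ℚ :- p) :* con 1ℚ) :* t := (con 1ℚ :- p) :* t) refl p _)
    (cong ((1ℚ ℚ.- p) ^ℚ_) (1+[n⊓a] n<a))
    where n<a = <ᵇ-true⁻ {n} {a} eq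
  ... | false = trans (solve 2 (λ p t → (p :* con 1ℚ :+ (con 1ℚ :- p) :* con 1ℚ) :* t := t) refl p _)
    (cong ((1ℚ ℚ.- p) ^ℚ_) (n⊓a≡[1+n]⊓a a≤n))
    where a≤n = <ᵇ-false⁻ {n} {a} eq

weight : ℚ → Bool → ℚ
weight y b = if b then y else 1ℚ

^-∣∷∣ : ∀ {n} y b (S : Subset n) → y ^ℚ ∣ b ∷ S ∣ ≡ weight y b ℚ.* y ^ℚ ∣ S ∣
^-∣∷∣ y true  S = refl
^-∣∷∣ y false S = sym (ℚₚ.*-identityˡ _)

module _ {p z : ℚ} (0≤p : 0ℚ ℚ.≤ p) (p≤1 : p ℚ.≤ 1ℚ) (0≤z : 0ℚ ℚ.≤ z) (a : ℕ) where

  private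
    y = 1ℚ ℚ.+ z
    q = (1ℚ ℚ.- p) ^ℚ a
    0≤y : 0ℚ ℚ.≤ y
    0≤y = 0≤+ 0≤1 0≤z
    0≤q : 0ℚ ℚ.≤ q
    0≤q = 0≤^ a (0≤b-a p≤1)
    1≤1+qz : 1ℚ ℚ.≤ 1ℚ ℚ.+ q ℚ.* z
    1≤1+qz = a≤a+b (0≤* 0≤q 0≤z)

  -- The weight is `1 + z 𝟙`, linear in the indicator, so its mean is `1 + z` times the probability
  -- of no edge. With `a ≤ n` that probability is exactly `q`.
  Σ-weight-noEdgeToLast : ∀ n → a ℕ.≤ n →
    Σℚ (λ r → rowProb p r ℚ.* weight y (noEdgeToLast a r)) (allRows n) ≡ 1ℚ ℚ.+ q ℚ.* z
  Σ-weight-noEdgeToLast n a≤n = begin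
    Σℚ (λ r → rowProb p r ℚ.* weight y (noEdgeToLast a r)) (allRows n)
      ≡⟨ Σ-cong (λ r → expand (rowProb p r) (noEdgeToLast a r)) (allRows n) ⟩
    Σℚ (λ r → rowProb p r ℚ.+ z ℚ.* (rowProb p r ℚ.* 𝟙 (noEdgeToLast a r))) (allRows n)
      ≡⟨ Σ-+ (rowProb p) (λ r → z ℚ.* (rowProb p r ℚ.* 𝟙 (noEdgeToLast a r))) (allRows n) ⟩
    Σℚ (rowProb p) (allRows n) ℚ.+ Σℚ (λ r → z ℚ.* (rowProb p r ℚ.* 𝟙 (noEdgeToLast a r))) (allRows n)
      ≡⟨ cong₂ ℚ._+_ (Σ-rowProb n p) (Σ-*ˡ z (λ r → rowProb p r ℚ.* 𝟙 (noEdgeToLast a r)) (allRows n)) ⟩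
    1ℚ ℚ.+ z ℚ.* Σℚ (λ r → rowProb p r ℚ.* 𝟙 (noEdgeToLast a r)) (allRows n)
      ≡⟨ cong (λ t → 1ℚ ℚ.+ z ℚ.* t) (trans (P[noEdgeToLast] n a p) (cong ((1ℚ ℚ.- p) ^ℚ_) (ℕₚ.m≥n⇒m⊓n≡n a≤n))) ⟩
    1ℚ ℚ.+ z ℚ.* q
      ≡⟨ cong (1ℚ ℚ.+_) (ℚₚ.*-comm z q) ⟩
    1ℚ ℚ.+ q ℚ.* z ∎
    where
    open ≡-Reasoning
    expand : ∀ t b → t ℚ.* weight y b ≡ t ℚ.+ z ℚ.* (t ℚ.* 𝟙 b)
    expand t true  = solve 2 (λ t z → t :* (con 1ℚ :+ z) := t :+ z :* (t :* con 1ℚ)) refl t z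
    expand t false = solve 2 (λ t z → t :* con 1ℚ := t :+ z :* (t :* con 0ℚ)) refl t z

  -- The expectation factors over the rows: a vertex among the last `a` contributes `y`, any other
  -- `1 + q z`.
  𝔼[y^∣completion∣] : ∀ n → 𝔼 n p (λ G → y ^ℚ ∣ completion a G ∣) ℚ.≤ y ^ℚ (n ℕ.⊓ a) ℚ.* (1ℚ ℚ.+ q ℚ.* z) ^ℚ n
  𝔼[y^∣completion∣] zero    = ℚₚ.≤-reflexive refl
  𝔼[y^∣completion∣] (suc n) = begin
    𝔼 (suc n) p (λ G → y ^ℚ ∣ completion a G ∣)
      ≡⟨ Σ-product rowFactor (λ G → prob p G ℚ.* y ^ℚ ∣ completion a G ∣) factor (allRows n) (allGraphs n) ⟩
    Σℚ rowFactor (allRows n) ℚ.* 𝔼 n p (λ G → y ^ℚ ∣ completion a G ∣)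
      ≤⟨ *-mono (Σ-nonneg 0≤rowFactor (allRows n)) 0≤𝔼 ℚₚ.≤-refl (𝔼[y^∣completion∣] n) ⟩
    Σℚ rowFactor (allRows n) ℚ.* (y ^ℚ (n ℕ.⊓ a) ℚ.* R ^ℚ n)
      ≤⟨ step ⟩
    y ^ℚ (suc n ℕ.⊓ a) ℚ.* (R ℚ.* R ^ℚ n) ∎
    where
    open ℚₚ.≤-Reasoning
    R = 1ℚ ℚ.+ q ℚ.* z
    0≤R : 0ℚ ℚ.≤ R
    0≤R = ℚₚ.≤-trans 0≤1 1≤1+qz
    rowFactor : Vec Bool n → ℚ
    rowFactor r = rowProb p r ℚ.* weight y ((n ℕ.<ᵇ a) ∨ noEdgeToLast a r)
    0≤weight : ∀ b → 0ℚ ℚ.≤ weight y b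
    0≤weight true  = 0≤y
    0≤weight false = 0≤1
    0≤rowFactor : ∀ r → 0ℚ ℚ.≤ rowFactor r
    0≤rowFactor r = 0≤* (0≤rowProb 0≤p p≤1 r) (0≤weight _)
    0≤𝔼 : 0ℚ ℚ.≤ 𝔼 n p (λ G → y ^ℚ ∣ completion a G ∣)
    0≤𝔼 = Σ-nonneg (λ G → 0≤* (0≤prob 0≤p p≤1 G) (0≤^ ∣ completion a G ∣ 0≤y)) (allGraphs n)
    factor : ∀ r G → prob p (r ∷ G) ℚ.* y ^ℚ ∣ completion a (r ∷ G) ∣ ≡ rowFactor r ℚ.* (prob p G ℚ.* y ^ℚ ∣ completion a G ∣)
    factor r G = trans (cong (prob p (r ∷ G) ℚ.*_) (^-∣∷∣ y ((n ℕ.<ᵇ a) ∨ noEdgeToLast a r) (completion a G)))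
      (solve 4 (λ x y z w → (x :* y) :* (z :* w) := (x :* z) :* (y :* w)) refl
        (rowProb p r) (prob p G) (weight y ((n ℕ.<ᵇ a) ∨ noEdgeToLast a r)) (y ^ℚ ∣ completion a G ∣))
    step : Σℚ rowFactor (allRows n) ℚ.* (y ^ℚ (n ℕ.⊓ a) ℚ.* R ^ℚ n) ℚ.≤ y ^ℚ (suc n ℕ.⊓ a) ℚ.* (R ℚ.* R ^ℚ n)
    step with n ℕ.<ᵇ a in eq
    ... | true = begin
      Σℚ (λ r → rowProb p r ℚ.* y) (allRows n) ℚ.* (y ^ℚ (n ℕ.⊓ a) ℚ.* R ^ℚ n)
        ≡⟨ cong (ℚ._* (y ^ℚ (n ℕ.⊓ a) ℚ.* R ^ℚ n)) Σ≡y ⟩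
      y ℚ.* (y ^ℚ (n ℕ.⊓ a) ℚ.* R ^ℚ n)
        ≡⟨ solve 3 (λ u v w → u :* (v :* w) := (u :* v) :* (con 1ℚ :* w)) refl y (y ^ℚ (n ℕ.⊓ a)) (R ^ℚ n) ⟩
      y ^ℚ suc (n ℕ.⊓ a) ℚ.* (1ℚ ℚ.* R ^ℚ n)
        -- A factor `1` is raised to `R`, so that the exponent of `R` is the number of all vertices
        -- and not only of those outside the core.
        ≤⟨ *-monoˡ (0≤^ (suc (n ℕ.⊓ a)) 0≤y) (*-monoʳ (0≤^ n 0≤R) 1≤1+qz) ⟩
      y ^ℚ suc (n ℕ.⊓ a) ℚ.* (R ℚ.* R ^ℚ n)
        ≡⟨ cong (λ e → y ^ℚ e ℚ.* (R ℚ.* R ^ℚ n)) (1+[n⊓a] n<a) ⟩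
      y ^ℚ (suc n ℕ.⊓ a) ℚ.* (R ℚ.* R ^ℚ n) ∎
      where
      n<a = <ᵇ-true⁻ {n} {a} eq
      Σ≡y : Σℚ (λ r → rowProb p r ℚ.* y) (allRows n) ≡ y
      Σ≡y = trans (Σ-cong (λ r → ℚₚ.*-comm (rowProb p r) y) (allRows n))
        (trans (Σ-*ˡ y (rowProb p) (allRows n)) (trans (cong (y ℚ.*_) (Σ-rowProb n p)) (ℚₚ.*-identityʳ y)))
    ... | false = ℚₚ.≤-reflexive (trans
      (cong₂ (λ s e → s ℚ.* (y ^ℚ e ℚ.* R ^ℚ n)) (Σ-weight-noEdgeToLast n a≤n) (n⊓a≡[1+n]⊓a a≤n))
      (solve 3 (λ u v w → u :* (v :* w) := v :* (u :* w)) refl R (y ^ℚ (suc n ℕ.⊓ a)) (R ^ℚ n)))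
      where a≤n = <ᵇ-false⁻ {n} {a} eq

-- Explored nodes

-- Filling with `inside` gives the vertex set of a node of depth `δ`; filling with `outside` leaves
-- exactly the kept vertices among the decided ones.
pad : ∀ {n} → Bool → ℕ → Vec Bool n → Vec Bool n
pad b δ       []       = []
pad b zero    (x ∷ xs) = b ∷ pad b zero xs
pad b (suc δ) (x ∷ xs) = x ∷ pad b δ xs

pad-overwrite : ∀ {n} b c δ (x : Vec Bool n) → pad b δ (pad c δ x) ≡ pad b δ x
pad-overwrite b c δ       []       = refl
pad-overwrite b c zero    (x ∷ xs) = cong (b ∷_) (pad-overwrite b c zero xs)
pad-overwrite b c (suc δ) (x ∷ xs) = cong (x ∷_) (pad-overwrite b c δ xs)

pad-fixed : ∀ {n} b δ (x : Vec Bool n) → (∀ i → δ ℕ.≤ toℕ i → lookup x i ≡ b) → pad b δ x ≡ x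
pad-fixed b δ       []       h = refl
pad-fixed b zero    (x ∷ xs) h = cong₂ _∷_ (sym (h zero z≤n)) (pad-fixed b zero xs (λ i _ → h (suc i) z≤n))
pad-fixed b (suc δ) (x ∷ xs) h = cong (x ∷_) (pad-fixed b δ xs (λ i le → h (suc i) (s≤s le)))

lookup-pad : ∀ {n} b δ (x : Vec Bool n) i → δ ℕ.≤ toℕ i → lookup (pad b δ x) i ≡ b
lookup-pad b zero    (x ∷ xs) zero    _        = refl
lookup-pad b zero    (x ∷ xs) (suc i) _        = lookup-pad b zero xs i z≤n
lookup-pad b (suc δ) (x ∷ xs) (suc i) (s≤s le) = lookup-pad b δ xs i le

∣pad-inside∣ : ∀ {n} δ (x : Subset n) → δ ℕ.≤ n → ∣ pad inside δ x ∣ ℕ.+ δ ≡ n ℕ.+ ∣ pad outside δ x ∣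
∣pad-inside∣ zero    []           _       = refl
∣pad-inside∣ zero    (x ∷ xs)     _       = cong suc (∣pad-inside∣ zero xs z≤n)
∣pad-inside∣ (suc δ) (false ∷ xs) (s≤s h) = trans (ℕₚ.+-suc _ δ) (cong suc (∣pad-inside∣ δ xs h))
∣pad-inside∣ (suc δ) (true ∷ xs)  (s≤s h) =
  cong suc (trans (ℕₚ.+-suc _ δ) (trans (cong suc (∣pad-inside∣ δ xs h)) (sym (ℕₚ.+-suc _ _))))

∣pad-outside∣≤ : ∀ {n} δ (x : Subset n) → ∣ pad outside δ x ∣ ℕ.≤ ∣ x ∣
∣pad-outside∣≤ δ       []           = z≤n
∣pad-outside∣≤ zero    (false ∷ xs) = ∣pad-outside∣≤ zero xs
∣pad-outside∣≤ zero    (true ∷ xs)  = ℕₚ.m≤n⇒m≤1+n (∣pad-outside∣≤ zero xs)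
∣pad-outside∣≤ (suc δ) (false ∷ xs) = ∣pad-outside∣≤ δ xs
∣pad-outside∣≤ (suc δ) (true ∷ xs)  = s≤s (∣pad-outside∣≤ δ xs)

pad-inside-⊇ : ∀ {n} δ {x : Subset n} {v} → v ∈ₛ x → v ∈ₛ pad inside δ x
pad-inside-⊇ zero    Vec.here       = Vec.here
pad-inside-⊇ zero    (Vec.there v∈) = Vec.there (pad-inside-⊇ zero v∈)
pad-inside-⊇ (suc δ) Vec.here       = Vec.here
pad-inside-⊇ (suc δ) (Vec.there v∈) = Vec.there (pad-inside-⊇ δ v∈)

pad-suc : ∀ {n} δ (δ<n : δ ℕ.< n) (x : Subset n) →
  pad inside (suc δ) x ≡ pad inside δ x ⊎ pad inside (suc δ) x ≡ pad inside δ x [ fromℕ< δ<n ]≔ outside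
pad-suc zero    (s≤s _)   (true  ∷ xs) = inj₁ refl
pad-suc zero    (s≤s _)   (false ∷ xs) = inj₂ refl
pad-suc (suc δ) (s≤s δ<n) (x ∷ xs)     = Sum.map (cong (x ∷_)) (cong (x ∷_)) (pad-suc δ δ<n xs)

module _ {n : ℕ} where

  node-≡ : ∀ {μ ν : Node n} → chosen μ ≡ chosen ν → depth μ ≡ depth ν → μ ≡ ν
  node-≡ refl refl = refl

  _≟_ : DecidableEquality (Node n)
  μ ≟ ν = map′ (λ (p , q) → node-≡ p q) (λ { refl → refl , refl })
    (Vecₚ.≡-dec Boolₚ._≟_ (chosen μ) (chosen ν) ×-dec (depth μ ℕₚ.≟ depth ν))

  open DecMembership _≟_ using (_∈?_)

  depth≤n : (ν : Node n) → depth ν ℕ.≤ n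
  depth≤n (node _ δ δ≤n _) = recompute (δ ℕₚ.≤? n) δ≤n

  pad-chosen : (ν : Node n) → pad inside (depth ν) (chosen ν) ≡ chosen ν
  -- The invariant on undecided vertices is an irrelevant field; decidable equality makes it usable
  -- here.
  pad-chosen (node x δ _ u) = recompute (Vecₚ.≡-dec Boolₚ._≟_ (pad inside δ x) x) (pad-fixed inside δ x u)

  kept : Node n → Subset n
  kept ν = pad outside (depth ν) (chosen ν)

  score≡∣kept∣ : (ν : Node n) → score ν ≡ ∣ kept ν ∣
  score≡∣kept∣ ν = trans
    (cong (ℕ._∸ n) (trans (cong (λ x → ∣ x ∣ ℕ.+ depth ν) (sym (pad-chosen ν))) (∣pad-inside∣ (depth ν) (chosen ν) (depth≤n ν))))
    (ℕₚ.m+n∸m≡n n ∣ kept ν ∣)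

  -- Unlike `chosen`, `kept` has the score as its size, so that the sum of weights over all pairs of
  -- a subset and a depth factors over the coordinates.
  code : Node n → Vec Bool n × ℕ
  code ν = kept ν , depth ν

  code-injective : ∀ {μ ν} → code μ ≡ code ν → μ ≡ ν
  code-injective {μ} {ν} eq = node-≡
    (trans (sym (recover μ)) (trans (cong (λ (x , δ) → pad inside δ x) eq) (recover ν)))
    (cong proj₂ eq)
    where
    recover : ∀ ν → pad inside (depth ν) (kept ν) ≡ chosen ν
    recover ν = trans (pad-overwrite inside outside (depth ν) (chosen ν)) (pad-chosen ν)

  module _ (D : Subset n) where

    -- The branch of the search tree towards `D`: its node at depth `δ` decides the first `δ`
    -- vertices as `D` does.
    prefix : ∀ δ → .(δ ℕ.≤ n) → Node n
    prefix δ δ≤n = node (pad inside δ D) δ δ≤n (lookup-pad inside δ D)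

    prefix-child : ∀ δ (δ<n : δ ℕ.< n) → prefix (suc δ) δ<n ChildOf prefix δ (ℕₚ.<⇒≤ δ<n)
    prefix-child δ δ<n with pad-suc δ δ<n D
    ... | inj₁ eq = subst (_ChildOf prefix δ (ℕₚ.<⇒≤ δ<n)) (sym (node-≡ eq refl)) (left δ<n)
    ... | inj₂ eq = subst (_ChildOf prefix δ (ℕₚ.<⇒≤ δ<n)) (sym (node-≡ eq refl)) (right δ<n)

    score-prefix≤ : ∀ δ .(δ≤n : δ ℕ.≤ n) → score (prefix δ δ≤n) ℕ.≤ ∣ D ∣
    score-prefix≤ δ δ≤n = begin
      score (prefix δ δ≤n)                    ≡⟨ score≡∣kept∣ (prefix δ δ≤n) ⟩
      ∣ pad outside δ (pad inside δ D) ∣      ≡⟨ cong ∣_∣ (pad-overwrite outside inside δ D) ⟩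
      ∣ pad outside δ D ∣                     ≤⟨ ∣pad-outside∣≤ δ D ⟩
      ∣ D ∣                                   ∎
      where open ℕₚ.≤-Reasoning

    -- The branch towards `D` starts at the root, which is listed, and ends at depth `n`, where no
    -- listed node lies. Hence somewhere it leaves the list.
    frontier : ∀ {νs : List (Node n)} → root ∈ νs → All (λ ν → depth ν ≢ n) νs →
      ∃[ δ ] ∃[ δ<n ] (prefix δ (ℕₚ.<⇒≤ δ<n) ∈ νs × prefix (suc δ) δ<n ∉ νs)
    frontier {νs} root∈ open-νs = walk n 0 (ℕₚ.+-identityʳ n)
      (subst (_∈ νs) (node-≡ (trans (sym (pad-chosen root)) (pad-⊤ D)) refl) root∈)
      where
      pad-⊤ : ∀ {m} (D : Subset m) → pad inside 0 (⊤ {m}) ≡ pad inside 0 D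
      pad-⊤ []      = refl
      pad-⊤ (_ ∷ D) = cong (inside ∷_) (pad-⊤ D)
      -- `k` counts the levels left below depth `δ` and makes the recursion structural.
      walk : ∀ k δ (k+δ≡n : k ℕ.+ δ ≡ n) → prefix δ (subst (δ ℕ.≤_) k+δ≡n (ℕₚ.m≤n+m δ k)) ∈ νs →
        ∃[ δ ] ∃[ δ<n ] (prefix δ (ℕₚ.<⇒≤ δ<n) ∈ νs × prefix (suc δ) δ<n ∉ νs)
      walk zero    δ refl p∈ = contradiction refl (All.lookup open-νs p∈)
      walk (suc k) δ eq p∈ with prefix (suc δ) (subst (δ ℕ.<_) eq (s≤s (ℕₚ.m≤n+m δ k))) ∈? νs
      ... | yes q∈ = walk k (suc δ) (trans (ℕₚ.+-suc k δ) eq) q∈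
      ... | no  q∉ = δ , subst (δ ℕ.<_) eq (s≤s (ℕₚ.m≤n+m δ k)) , p∈ , q∉

  module _ {G : Graph n} where

    root∈trace : ∀ {νs} → Trace G νs → root ∈ νs
    root∈trace start           = here refl
    root∈trace (explore t _ _) = there (root∈trace t)

    trace-unfinished : ∀ {μ μs} → Trace G (μ ∷ μs) → depth μ ≢ n → All (λ ν → depth ν ≢ n) (μ ∷ μs)
    trace-unfinished start           μ≢n = μ≢n ∷ []
    trace-unfinished (explore t h _) μ≢n = μ≢n ∷ trace-unfinished t h

    trace-unique : ∀ {νs} → Trace G νs → Unique νs
    trace-unique start                              = [] ∷ []
    trace-unique (explore t _ ((_ , ν∉ , _) , _)) = Allₚ.¬Any⇒All¬ _ ν∉ ∷ trace-unique t

    -- Before each exploration the branch towards `D` supplies a candidate of score at most `∣ D ∣`,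
    -- feasible because its vertex set contains `D`. The selected node has minimum score.
    trace-score≤ : ∀ {D} → Dominating G D → ∀ {νs} → Trace G νs → All (λ ν → score ν ℕ.≤ ∣ D ∣) νs
    trace-score≤ {D} dom start = subst (ℕ._≤ ∣ D ∣) (sym score-root) z≤n ∷ []
      where
      score-root : score {n} root ≡ 0
      score-root = trans (score≡∣kept∣ root) (∣pad-outside-0∣ {n} ⊤)
        where
        ∣pad-outside-0∣ : ∀ {m} (x : Subset m) → ∣ pad outside 0 x ∣ ≡ 0
        ∣pad-outside-0∣ []      = refl
        ∣pad-outside-0∣ (_ ∷ x) = ∣pad-outside-0∣ x
    trace-score≤ {D} dom (explore t μ≢n (_ , minimal)) =
      ℕₚ.≤-trans (minimal _ candidate) (score-prefix≤ D (suc δ) δ<n) ∷ trace-score≤ dom t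
      where
      exit = frontier D (root∈trace t) (trace-unfinished t μ≢n)
      δ = proj₁ exit
      δ<n = proj₁ (proj₂ exit)
      feasible : Feasible G (prefix D (suc δ) δ<n)
      feasible v = Sum.map (pad-inside-⊇ (suc δ)) (λ (u , u∈ , vu) → u , pad-inside-⊇ (suc δ) u∈ , vu) (dom v)
      candidate : Candidate G _ (prefix D (suc δ) δ<n)
      candidate = (prefix D δ (ℕₚ.<⇒≤ δ<n) , proj₁ (proj₂ (proj₂ exit)) , prefix-child D δ δ<n)
        , proj₂ (proj₂ (proj₂ exit)) , feasible

-- Counting the explored nodes by weights.

∈-allRows : ∀ {n} (r : Vec Bool n) → r ∈ allRows n
∈-allRows []          = here refl
∈-allRows (true ∷ r)  = ∈-cartesianProductWith⁺ _∷_ {xs = true ∷ false ∷ []} (here refl) (∈-allRows r)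
∈-allRows (false ∷ r) = ∈-cartesianProductWith⁺ _∷_ {xs = true ∷ false ∷ []} (there (here refl)) (∈-allRows r)

Σ-x^∣r∣ : ∀ x n → Σℚ (λ r → x ^ℚ ∣ r ∣) (allRows n) ≡ (1ℚ ℚ.+ x) ^ℚ n
Σ-x^∣r∣ x zero    = refl
Σ-x^∣r∣ x (suc n) = trans (Σ-rows n _ (weight x) (λ r → x ^ℚ ∣ r ∣) (^-∣∷∣ x))
  (cong₂ ℚ._*_ (ℚₚ.+-comm x 1ℚ) (Σ-x^∣r∣ x n))

-- With `x = 1/y`, each explored node has weight `y^∣D∣ x^score ≥ 1`. Distinct nodes have distinct
-- codes, so the total weight is at most that of all pairs of a subset and a depth.
explored≤ : ∀ {n} {G : Graph n} {D} → Dominating G D → ∀ {x y} → 0ℚ ℚ.≤ x → 1ℚ ℚ.≤ y → x ℚ.* y ≡ 1ℚ →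
  (ρ : Run G) → ι (exploredNodes ρ) ℚ.≤ (1ℚ ℚ.+ x) ^ℚ n ℚ.* ι (suc n) ℚ.* y ^ℚ ∣ D ∣
explored≤ {n} {G} {D} dom {x} {y} 0≤x 1≤y xy≡1 (run {final} {earlier} t _) = begin
  ι (length νs)
    ≡⟨ Σ-1 νs ⟨
  Σℚ (const 1ℚ) νs
    ≤⟨ Σ-mono (All.map (λ {ν} → 1≤ ν) (trace-score≤ dom t)) ⟩
  Σℚ (λ ν → y ^ℚ ∣ D ∣ ℚ.* w (code ν)) νs
    ≡⟨ Σ-*ˡ (y ^ℚ ∣ D ∣) (λ ν → w (code ν)) νs ⟩
  y ^ℚ ∣ D ∣ ℚ.* Σℚ (λ ν → w (code ν)) νs
    ≡⟨ cong (λ s → y ^ℚ ∣ D ∣ ℚ.* foldr ℚ._+_ 0ℚ s) (map-∘ {g = w} {f = code} νs) ⟩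
  y ^ℚ ∣ D ∣ ℚ.* Σℚ w (map code νs)
    ≤⟨ *-monoˡ (0≤^ ∣ D ∣ (ℚₚ.≤-trans 0≤1 1≤y)) (Σ-⊆ (λ (r , _) → 0≤^ ∣ r ∣ 0≤x) (Uniqueₚ.map⁺ code-injective (trace-unique t)) codes⊆) ⟩
  y ^ℚ ∣ D ∣ ℚ.* Σℚ w (cartesianProduct (allRows n) (upTo (suc n)))
    ≡⟨ cong (y ^ℚ ∣ D ∣ ℚ.*_) (Σ-product (λ r → x ^ℚ ∣ r ∣) (const 1ℚ) (λ r _ → sym (ℚₚ.*-identityʳ _)) (allRows n) (upTo (suc n))) ⟩
  y ^ℚ ∣ D ∣ ℚ.* (Σℚ (λ r → x ^ℚ ∣ r ∣) (allRows n) ℚ.* Σℚ (const 1ℚ) (upTo (suc n)))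
    ≡⟨ cong₂ (λ s t → y ^ℚ ∣ D ∣ ℚ.* (s ℚ.* t)) (Σ-x^∣r∣ x n) (trans (Σ-1 (upTo (suc n))) (cong ι (length-upTo (suc n)))) ⟩
  y ^ℚ ∣ D ∣ ℚ.* ((1ℚ ℚ.+ x) ^ℚ n ℚ.* ι (suc n))
    ≡⟨ ℚₚ.*-comm (y ^ℚ ∣ D ∣) ((1ℚ ℚ.+ x) ^ℚ n ℚ.* ι (suc n)) ⟩
  (1ℚ ℚ.+ x) ^ℚ n ℚ.* ι (suc n) ℚ.* y ^ℚ ∣ D ∣ ∎
  where
  open ℚₚ.≤-Reasoning
  νs = final ∷ earlier
  w : Vec Bool n × ℕ → ℚ
  w (r , _) = x ^ℚ ∣ r ∣
  1≤ : ∀ ν → score ν ℕ.≤ ∣ D ∣ → 1ℚ ℚ.≤ y ^ℚ ∣ D ∣ ℚ.* x ^ℚ ∣ kept ν ∣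
  1≤ ν h = begin
    1ℚ                                       ≡⟨ 1^ ∣ kept ν ∣ ⟨
    1ℚ ^ℚ ∣ kept ν ∣                         ≡⟨ cong (_^ℚ ∣ kept ν ∣) (trans (ℚₚ.*-comm y x) xy≡1) ⟨
    (y ℚ.* x) ^ℚ ∣ kept ν ∣                  ≡⟨ ^-distrib-* y x ∣ kept ν ∣ ⟩
    y ^ℚ ∣ kept ν ∣ ℚ.* x ^ℚ ∣ kept ν ∣      ≤⟨ *-monoʳ (0≤^ ∣ kept ν ∣ 0≤x) (^-monoʳ 1≤y (subst (ℕ._≤ ∣ D ∣) (score≡∣kept∣ ν) h)) ⟩
    y ^ℚ ∣ D ∣ ℚ.* x ^ℚ ∣ kept ν ∣           ∎
  codes⊆ : ∀ {c} → c ∈ map code νs → c ∈ cartesianProduct (allRows n) (upTo (suc n))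
  codes⊆ c∈ with ∈-map⁻ code {xs = νs} c∈
  ... | ν , _ , refl = ∈-cartesianProduct⁺ (∈-allRows (kept ν)) (∈-upTo⁺ (s≤s (depth≤n ν)))

module _ (τ : TieBreaking) where

  𝕋ℚ : ℕ → ℚ → ℚ
  𝕋ℚ n p = 𝔼 n p (λ G → ι (exploredNodes (τ G)))

  seq-𝕋 : ∀ n p k → seq (𝕋 τ n p) k ≡ 𝕋ℚ n (seq p k)
  seq-𝕋 n p k = seq-expectation n p (λ G → fromℕ (exploredNodes (τ G))) k

  -- Every run explores at least the root. This serves the lower half of `2^o(n)` and the
  -- monotonicity of `k`-th powers.
  1≤𝕋 : ∀ {n p} → 0ℚ ℚ.≤ p → p ℚ.≤ 1ℚ → 1ℚ ℚ.≤ 𝕋ℚ n p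
  1≤𝕋 {n} {p} 0≤p p≤1 = subst (ℚ._≤ 𝕋ℚ n p) (𝔼-1 n p) (𝔼-mono 0≤p p≤1 {n} (λ G → ι-mono {1} {exploredNodes (τ G)} (s≤s z≤n)))

  𝕋≤ : ∀ {n p x z} → 0ℚ ℚ.≤ p → p ℚ.≤ 1ℚ → 0ℚ ℚ.≤ x → 0ℚ ℚ.≤ z → x ℚ.* (1ℚ ℚ.+ z) ≡ 1ℚ → ∀ a →
    𝕋ℚ n p ℚ.≤ (1ℚ ℚ.+ x) ^ℚ n ℚ.* ι (suc n) ℚ.*
      ((1ℚ ℚ.+ z) ^ℚ a ℚ.* (1ℚ ℚ.+ (1ℚ ℚ.- p) ^ℚ a ℚ.* z) ^ℚ n)
  𝕋≤ {n} {p} {x} {z} 0≤p p≤1 0≤x 0≤z xy≡1 a = begin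
    𝕋ℚ n p
      ≤⟨ 𝔼-mono 0≤p p≤1 {n} (λ G → explored≤ (completion-dominating a G) 0≤x 1≤y xy≡1 (τ G)) ⟩
    𝔼 n p (λ G → C ℚ.* y ^ℚ ∣ completion a G ∣)
      ≡⟨ 𝔼-*ˡ n p C (λ G → y ^ℚ ∣ completion a G ∣) ⟩
    C ℚ.* 𝔼 n p (λ G → y ^ℚ ∣ completion a G ∣)
      ≤⟨ *-monoˡ 0≤C (𝔼[y^∣completion∣] 0≤p p≤1 0≤z a n) ⟩
    C ℚ.* (y ^ℚ (n ℕ.⊓ a) ℚ.* R ^ℚ n)
      ≤⟨ *-monoˡ 0≤C (*-monoʳ (0≤^ n 0≤R) (^-monoʳ 1≤y (ℕₚ.m⊓n≤n n a))) ⟩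
    C ℚ.* (y ^ℚ a ℚ.* R ^ℚ n) ∎
    where
    open ℚₚ.≤-Reasoning
    y R C : ℚ
    y = 1ℚ ℚ.+ z
    R = 1ℚ ℚ.+ (1ℚ ℚ.- p) ^ℚ a ℚ.* z
    C = (1ℚ ℚ.+ x) ^ℚ n ℚ.* ι (suc n)
    1≤y : 1ℚ ℚ.≤ y
    1≤y = a≤a+b 0≤z
    0≤C : 0ℚ ℚ.≤ C
    0≤C = 0≤* (0≤^ n (0≤+ 0≤1 0≤x)) (0≤ι (suc n))
    0≤R : 0ℚ ℚ.≤ R
    0≤R = 0≤+ 0≤1 (0≤* (0≤^ a (0≤b-a p≤1)) 0≤z)

-- Real numbers

p≤ι∣↥p∣ : ∀ p → p ℚ.≤ ι ℤ.∣ ℚ.↥ p ∣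
p≤ι∣↥p∣ p@(ℚ.mkℚ n d _) = ℚₚ.toℚᵘ-cancel-≤ (ℚᵘₚ.≤-trans
  (*≤* (begin
    n ℤ.* + 1                   ≡⟨ ℤₚ.*-identityʳ n ⟩
    n                           ≤⟨ n≤∣n∣ n ⟩
    + ℤ.∣ n ∣                   ≤⟨ +≤+ (ℕₚ.m≤m*n ℤ.∣ n ∣ (suc d)) ⟩
    + (ℤ.∣ n ∣ ℕ.* suc d)       ≡⟨ ℤₚ.pos-* ℤ.∣ n ∣ (suc d) ⟩
    + ℤ.∣ n ∣ ℤ.* + suc d       ∎))
  (ℚᵘₚ.≤-reflexive (ℚᵘₚ.≃-sym (ℚₚ.toℚᵘ-fromℚᵘ (mkℚᵘ (+ ℤ.∣ n ∣) 0)))))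
  where
  open ℤₚ.≤-Reasoning
  n≤∣n∣ : ∀ n → n ℤ.≤ + ℤ.∣ n ∣
  n≤∣n∣ (+ n)        = ℤₚ.≤-refl
  n≤∣n∣ ℤ.-[1+ n ]   = ℤ.-≤+

a≤∣a∣ : ∀ a → a ℚ.≤ ℚ.∣ a ∣
a≤∣a∣ a with ℚₚ.≤-total 0ℚ a
... | inj₁ 0≤a = ℚₚ.≤-reflexive (sym (ℚₚ.0≤p⇒∣p∣≡p 0≤a))
... | inj₂ a≤0 = ℚₚ.≤-trans a≤0 (ℚₚ.0≤∣p∣ a)

a≤b+∣a-b∣ : ∀ {ε} a b → ℚ.∣ a ℚ.- b ∣ ℚ.≤ ε → a ℚ.≤ b ℚ.+ ε
a≤b+∣a-b∣ {ε} a b h = begin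
  a                        ≡⟨ solve 2 (λ a b → a := b :+ (a :- b)) refl a b ⟩
  b ℚ.+ (a ℚ.- b)          ≤⟨ ℚₚ.+-monoʳ-≤ b (ℚₚ.≤-trans (a≤∣a∣ _) h) ⟩
  b ℚ.+ ε                  ∎
  where open ℚₚ.≤-Reasoning

∣a-b∣≡∣b-a∣ : ∀ a b → ℚ.∣ a ℚ.- b ∣ ≡ ℚ.∣ b ℚ.- a ∣
∣a-b∣≡∣b-a∣ a b = trans (sym (ℚₚ.∣-p∣≡∣p∣ (a ℚ.- b)))
  (cong ℚ.∣_∣ (solve 2 (λ a b → :- (a :- b) := b :- a) refl a b))

∣a-c∣≤ : ∀ {ε δ} a b c → ℚ.∣ a ℚ.- b ∣ ℚ.≤ ε → ℚ.∣ b ℚ.- c ∣ ℚ.≤ δ → ℚ.∣ a ℚ.- c ∣ ℚ.≤ ε ℚ.+ δ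
∣a-c∣≤ {ε} {δ} a b c h g = begin
  ℚ.∣ a ℚ.- c ∣                         ≡⟨ cong ℚ.∣_∣ (solve 3 (λ a b c → a :- c := (a :- b) :+ (b :- c)) refl a b c) ⟩
  ℚ.∣ (a ℚ.- b) ℚ.+ (b ℚ.- c) ∣         ≤⟨ ℚₚ.∣p+q∣≤∣p∣+∣q∣ (a ℚ.- b) (b ℚ.- c) ⟩
  ℚ.∣ a ℚ.- b ∣ ℚ.+ ℚ.∣ b ℚ.- c ∣       ≤⟨ ℚₚ.+-mono-≤ h g ⟩
  ε ℚ.+ δ                               ∎
  where open ℚₚ.≤-Reasoning

0<½ε : ∀ {ε} → 0ℚ ℚ.< ε → 0ℚ ℚ.< ½ ℚ.* ε
0<½ε {ε} 0<ε = ℚₚ.positive⁻¹ (½ ℚ.* ε) {{ℚₚ.pos*pos⇒pos ½ ε {{ℚ.positive 0<ε}}}}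

½ε+½ε : ∀ ε → ½ ℚ.* ε ℚ.+ ½ ℚ.* ε ≡ ε
½ε+½ε = solve 1 (λ ε → con ½ :* ε :+ con ½ :* ε := ε) refl

-- Equivalent sequences and continuity of termwise operations.

_∼_ : (ℕ → ℚ) → (ℕ → ℚ) → Set
f ∼ g = ∀ ε → 0ℚ ℚ.< ε → ∃[ N ] (∀ k → N ℕ.≤ k → ℚ.∣ f k ℚ.- g k ∣ ℚ.≤ ε)

interleave : (ℕ → ℚ) → (ℕ → ℚ) → ℕ → ℚ
interleave f g zero          = f 0
interleave f g (suc zero)    = g 0
interleave f g (suc (suc k)) = interleave (f ∘ suc) (g ∘ suc) k

interleave-even : ∀ f g j → interleave f g (j ℕ.* 2) ≡ f j
interleave-even f g zero    = refl
interleave-even f g (suc j) = interleave-even (f ∘ suc) (g ∘ suc) j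

interleave-odd : ∀ f g j → interleave f g (suc (j ℕ.* 2)) ≡ g j
interleave-odd f g zero    = refl
interleave-odd f g (suc j) = interleave-odd (f ∘ suc) (g ∘ suc) j

interleave-eventually : ∀ (P : ℚ → Set) N f g → (∀ k → N ℕ.≤ k → P (f k) × P (g k)) →
  ∀ k → N ℕ.* 2 ℕ.≤ k → P (interleave f g k)
interleave-eventually P zero f g h zero          _ = proj₁ (h 0 z≤n)
interleave-eventually P zero f g h (suc zero)    _ = proj₂ (h 0 z≤n)
interleave-eventually P zero f g h (suc (suc k)) _ =
  interleave-eventually P zero (f ∘ suc) (g ∘ suc) (λ i _ → h (suc i) z≤n) k z≤n
interleave-eventually P (suc N) f g h (suc (suc k)) (s≤s (s≤s le)) =
  interleave-eventually P N (f ∘ suc) (g ∘ suc) (λ i le → h (suc i) (s≤s le)) k le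

-- Beyond index `2 N` every term is within `ε/2` of `f N`: a term of `f` by the Cauchy property, a
-- term of `g` by way of the corresponding term of `f`. Two steps of size `δ = ε/4` allow for this.
interleave-cauchy : ∀ {f g} → IsCauchy f → f ∼ g → IsCauchy (interleave f g)
interleave-cauchy {f} {g} cf f∼g ε 0<ε = N ℕ.* 2 , λ i j hi hj →
  subst (ℚ.∣ interleave f g i ℚ.- interleave f g j ∣ ℚ.≤_) (½ε+½ε ε)
    (∣a-c∣≤ (interleave f g i) (f N) (interleave f g j)
      (near i hi) (subst (ℚ._≤ ½ ℚ.* ε) (∣a-b∣≡∣b-a∣ (interleave f g j) (f N)) (near j hj)))
  where
  δ = ½ ℚ.* (½ ℚ.* ε)
  0<δ : 0ℚ ℚ.< δ
  0<δ = 0<½ε (0<½ε 0<ε)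
  N₁ = proj₁ (cf δ 0<δ)
  N₂ = proj₁ (f∼g δ 0<δ)
  N = N₁ ℕ.⊔ N₂
  f-near : ∀ k → N ℕ.≤ k → ℚ.∣ f k ℚ.- f N ∣ ℚ.≤ δ
  f-near k h = proj₂ (cf δ 0<δ) k N (ℕₚ.m⊔n≤o⇒m≤o N₁ N₂ h) (ℕₚ.m≤m⊔n N₁ N₂)
  near : ∀ i → N ℕ.* 2 ℕ.≤ i → ℚ.∣ interleave f g i ℚ.- f N ∣ ℚ.≤ ½ ℚ.* ε
  near = interleave-eventually (λ t → ℚ.∣ t ℚ.- f N ∣ ℚ.≤ ½ ℚ.* ε) N f g (λ k h →
      ℚₚ.≤-trans (f-near k h) (subst (δ ℚ.≤_) (½ε+½ε (½ ℚ.* ε)) (a≤a+b (ℚₚ.<⇒≤ 0<δ)))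
    , subst (ℚ.∣ g k ℚ.- f N ∣ ℚ.≤_) (½ε+½ε (½ ℚ.* ε)) (∣a-c∣≤ (g k) (f k) (f N)
        (subst (ℚ._≤ δ) (∣a-b∣≡∣b-a∣ (f k) (g k)) (proj₂ (f∼g δ 0<δ) k (ℕₚ.m⊔n≤o⇒n≤o N₁ N₂ h)))
        (f-near k h)))

-- Every operation on reals that acts termwise is continuous: applied to the
-- interleaving of two equivalent sequences, it gives a Cauchy sequence.
termwise-continuous : ∀ (F : ℝ → ℝ) (φ : ℚ → ℚ) → (∀ x k → seq (F x) k ≡ φ (seq x k)) →
  ∀ x {g} → seq x ∼ g → (φ ∘ seq x) ∼ (φ ∘ g)
termwise-continuous F φ termwise x {g} x∼g ε 0<ε = proj₁ (cauchy (F both) ε 0<ε) , λ k N≤k →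
  let N≤2k = ℕₚ.≤-trans N≤k (ℕₚ.m≤m*n k 2) in
  subst₂ (λ s t → ℚ.∣ s ℚ.- t ∣ ℚ.≤ ε)
    (trans (termwise both (k ℕ.* 2)) (cong φ (interleave-even (seq x) g k)))
    (trans (termwise both (suc (k ℕ.* 2))) (cong φ (interleave-odd (seq x) g k)))
    (proj₂ (cauchy (F both) ε 0<ε) (k ℕ.* 2) (suc (k ℕ.* 2)) N≤2k (ℕₚ.m≤n⇒m≤1+n N≤2k))
  where
  both : ℝ
  both = mkℝ (interleave (seq x) g) (interleave-cauchy {seq x} (cauchy x) x∼g)

-- A real number in `[0, 1]` may have rational terms slightly outside, where edge weights become
-- negative. The estimates are made at clamped terms and carried back by continuity.
clamp : ℚ → ℚ
clamp p = 0ℚ ℚ.⊔ (p ℚ.⊓ 1ℚ)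

0≤clamp : ∀ p → 0ℚ ℚ.≤ clamp p
0≤clamp p = ℚₚ.p≤p⊔q 0ℚ (p ℚ.⊓ 1ℚ)

clamp≤1 : ∀ p → clamp p ℚ.≤ 1ℚ
clamp≤1 p = ℚₚ.⊔-lub 0≤1 (ℚₚ.p⊓q≤q p 1ℚ)

data ClampView (p : ℚ) : Set where
  below  : p ℚ.≤ 0ℚ → clamp p ≡ 0ℚ → ClampView p
  within : clamp p ≡ p → ClampView p
  above  : 1ℚ ℚ.≤ p → clamp p ≡ 1ℚ → ClampView p

clampView : ∀ p → ClampView p
clampView p with ℚₚ.≤-total p 0ℚ | ℚₚ.≤-total p 1ℚ
... | inj₁ p≤0 | _        = below p≤0 (ℚₚ.p≥q⇒p⊔q≡p (ℚₚ.≤-trans (ℚₚ.p⊓q≤p p 1ℚ) p≤0))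
... | inj₂ 0≤p | inj₁ p≤1 = within (trans (cong (0ℚ ℚ.⊔_) (ℚₚ.p≤q⇒p⊓q≡p p≤1)) (ℚₚ.p≤q⇒p⊔q≡q 0≤p))
... | inj₂ 0≤p | inj₂ 1≤p = above 1≤p (trans (cong (0ℚ ℚ.⊔_) (ℚₚ.p≥q⇒p⊓q≡q 1≤p)) (ℚₚ.p≤q⇒p⊔q≡q 0≤1))

∣p-clamp∣≤ : ∀ {p ε} → 0ℚ ℚ.≤ ε → 0ℚ ℚ.≤ p ℚ.+ ε → p ℚ.≤ 1ℚ ℚ.+ ε → ℚ.∣ p ℚ.- clamp p ∣ ℚ.≤ ε
∣p-clamp∣≤ {p} {ε} 0≤ε 0≤p+ε p≤1+ε with clampView p
... | below p≤0 eq rewrite eq = begin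
  ℚ.∣ p ℚ.- 0ℚ ∣   ≡⟨ ∣a-b∣≡∣b-a∣ p 0ℚ ⟩
  ℚ.∣ 0ℚ ℚ.- p ∣   ≡⟨ ℚₚ.0≤p⇒∣p∣≡p (0≤b-a p≤0) ⟩
  0ℚ ℚ.- p         ≤⟨ ℚₚ.+-monoˡ-≤ (ℚ.- p) 0≤p+ε ⟩
  p ℚ.+ ε ℚ.- p    ≡⟨ solve 2 (λ p ε → p :+ ε :- p := ε) refl p ε ⟩
  ε                ∎
  where open ℚₚ.≤-Reasoning
... | within eq rewrite eq = subst (λ t → ℚ.∣ t ∣ ℚ.≤ ε) (sym (ℚₚ.+-inverseʳ p)) 0≤ε
... | above 1≤p eq rewrite eq = begin
  ℚ.∣ p ℚ.- 1ℚ ∣     ≡⟨ ℚₚ.0≤p⇒∣p∣≡p (0≤b-a 1≤p) ⟩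
  p ℚ.- 1ℚ           ≤⟨ ℚₚ.+-monoˡ-≤ (ℚ.- 1ℚ) p≤1+ε ⟩
  1ℚ ℚ.+ ε ℚ.- 1ℚ    ≡⟨ solve 1 (λ ε → con 1ℚ :+ ε :- con 1ℚ := ε) refl ε ⟩
  ε                  ∎
  where open ℚₚ.≤-Reasoning

clamp-∼ : ∀ x → 0ℝ ≤ x → x ≤ 1ℝ → seq x ∼ (clamp ∘ seq x)
clamp-∼ x 0≤x x≤1 ε 0<ε with 0≤x ε 0<ε | x≤1 ε 0<ε
... | M , lower | N , upper = M ℕ.⊔ N , λ k h → ∣p-clamp∣≤ (ℚₚ.<⇒≤ 0<ε)
  (lower k (ℕₚ.m⊔n≤o⇒m≤o M N h)) (upper k (ℕₚ.m⊔n≤o⇒n≤o M N h))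

-- Clamping raises negative terms and lowers only terms above 1, where `c ≤ n` takes over.
c≤pn⇒c≤clamp[p]n : ∀ {p c} n → c ℚ.≤ p ℚ.* ι n → c ℚ.≤ ι n → c ℚ.≤ clamp p ℚ.* ι n
c≤pn⇒c≤clamp[p]n {p} {c} n c≤pn c≤n with clampView p
... | below p≤0 eq rewrite eq = ℚₚ.≤-trans c≤pn (*-monoʳ (0≤ι n) p≤0)
... | within eq    rewrite eq = c≤pn
... | above _ eq   rewrite eq = subst (c ℚ.≤_) (sym (ℚₚ.*-identityˡ (ι n))) c≤n

-- The sparse and the dense regime

-- With `b = n / 8`, `7 n ≤ 56 b + 49`, and `b ≥ 49` because `392 = 8 · 49`. The factor
-- `57 = 3 · 19` matches `c ≥ 19`: for `p = c/n` it yields `b p ≥ 7/3`.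
7n≤57[n/8] : ∀ n → 392 ℕ.≤ n → 7 ℕ.* n ℕ.≤ 57 ℕ.* (n ℕ./ 8)
7n≤57[n/8] n 392≤n = begin
  7 ℕ.* n                          ≡⟨ cong (7 ℕ.*_) (m≡m%n+[m/n]*n n 8) ⟩
  7 ℕ.* (n ℕ.% 8 ℕ.+ b ℕ.* 8)      ≤⟨ ℕₚ.*-monoʳ-≤ 7 (ℕₚ.+-monoˡ-≤ (b ℕ.* 8) (ℕₚ.≤-pred (m%n<n n 8))) ⟩
  7 ℕ.* (7 ℕ.+ b ℕ.* 8)            ≡⟨ ℕ-solve 1 (λ b → ℕ-con 7 ⊠ (ℕ-con 7 ⊞ b ⊠ ℕ-con 8) ≐ ℕ-con 49 ⊞ ℕ-con 56 ⊠ b) refl b ⟩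
  49 ℕ.+ 56 ℕ.* b                  ≤⟨ ℕₚ.+-monoˡ-≤ (56 ℕ.* b) (/-mono-≤ {o = 8} 392≤n ℕₚ.≤-refl) ⟩
  57 ℕ.* b                         ∎
  where
  open ℕₚ.≤-Reasoning
  b = n ℕ./ 8

module _ (τ : TieBreaking) where

  -- The bases `3/2` from the subsets, `101/100` from the depths, `6/5` from the core and `109/100`
  -- from the vertices without neighbour in it multiply to `1.98162`.
  sparse : ∀ n .{{_ : NonZero n}} c → ι 19 ℚ.≤ c → c ℚ.≤ ι n → 4 ℕ.* (100 ℕ.* 100) ℕ.≤ n →
    𝕋ℚ τ n (c ℚ.* inv n) ℚ.≤ (+ 199 ℚ./ 100) ^ℚ n
  sparse n c 19≤c c≤n big = begin
    𝕋ℚ τ n p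
      -- `x = 1/2` and `z = 1`, that is `y = 2`; `a = 2 b` is even so that `q = s²`.
      ≤⟨ 𝕋≤ τ {n} 0≤p p≤1 (from-yes (0ℚ ℚₚ.≤? ½)) 0≤1 refl (b ℕ.* 2) ⟩
    (+ 3 ℚ./ 2) ^ℚ n ℚ.* ι (suc n) ℚ.* (ι 2 ^ℚ (b ℕ.* 2) ℚ.* (1ℚ ℚ.+ q ℚ.* 1ℚ) ^ℚ n)
      ≤⟨ *-mono (0≤* (0≤^ n 0≤3/2) (0≤ι (suc n))) (0≤* (0≤^ (b ℕ.* 2) (0≤ι 2)) (0≤^ n 0≤1+q))
           (*-monoˡ (0≤^ n 0≤3/2) (linear≤exponential 100 n big))
           (*-mono (0≤^ (b ℕ.* 2) (0≤ι 2)) (0≤^ n 0≤1+q) 4^b≤ (^-mono n 0≤1+q 1+q≤)) ⟩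
    (+ 3 ℚ./ 2) ^ℚ n ℚ.* (+ 101 ℚ./ 100) ^ℚ n ℚ.* ((+ 6 ℚ./ 5) ^ℚ n ℚ.* (+ 109 ℚ./ 100) ^ℚ n)
      ≡⟨ cong₂ ℚ._*_ (^-distrib-* (+ 3 ℚ./ 2) (+ 101 ℚ./ 100) n) (^-distrib-* (+ 6 ℚ./ 5) (+ 109 ℚ./ 100) n) ⟨
    ((+ 3 ℚ./ 2) ℚ.* (+ 101 ℚ./ 100)) ^ℚ n ℚ.* ((+ 6 ℚ./ 5) ℚ.* (+ 109 ℚ./ 100)) ^ℚ n
      ≡⟨ ^-distrib-* ((+ 3 ℚ./ 2) ℚ.* (+ 101 ℚ./ 100)) ((+ 6 ℚ./ 5) ℚ.* (+ 109 ℚ./ 100)) n ⟨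
    ((+ 3 ℚ./ 2) ℚ.* (+ 101 ℚ./ 100) ℚ.* ((+ 6 ℚ./ 5) ℚ.* (+ 109 ℚ./ 100))) ^ℚ n
      ≤⟨ ^-mono n (from-yes (0ℚ ℚₚ.≤? (+ 3 ℚ./ 2) ℚ.* (+ 101 ℚ./ 100) ℚ.* ((+ 6 ℚ./ 5) ℚ.* (+ 109 ℚ./ 100))))
           (from-yes ((+ 3 ℚ./ 2) ℚ.* (+ 101 ℚ./ 100) ℚ.* ((+ 6 ℚ./ 5) ℚ.* (+ 109 ℚ./ 100)) ℚₚ.≤? (+ 199 ℚ./ 100))) ⟩
    (+ 199 ℚ./ 100) ^ℚ n ∎
    where
    open ℚₚ.≤-Reasoning
    p = c ℚ.* inv n
    b = n ℕ./ 8
    s = (1ℚ ℚ.- p) ^ℚ b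
    q = (1ℚ ℚ.- p) ^ℚ (b ℕ.* 2)
    0≤3/2 : 0ℚ ℚ.≤ + 3 ℚ./ 2
    0≤3/2 = from-yes (0ℚ ℚₚ.≤? + 3 ℚ./ 2)
    0≤p : 0ℚ ℚ.≤ p
    0≤p = 0≤* (ℚₚ.≤-trans (0≤ι 19) 19≤c) (0≤inv n)
    p≤1 : p ℚ.≤ 1ℚ
    p≤1 = subst (p ℚ.≤_) (ι*inv n) (*-monoʳ (0≤inv n) c≤n)
    0≤s : 0ℚ ℚ.≤ s
    0≤s = 0≤^ b (0≤b-a p≤1)
    7≤3bp : ι 7 ℚ.≤ ι 3 ℚ.* (ι b ℚ.* p)
    7≤3bp = begin
      ι 7                                 ≡⟨ ℚₚ.*-identityʳ (ι 7) ⟨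
      ι 7 ℚ.* 1ℚ                          ≡⟨ cong (ι 7 ℚ.*_) (ι*inv n) ⟨
      ι 7 ℚ.* (ι n ℚ.* inv n)             ≡⟨ ℚₚ.*-assoc (ι 7) (ι n) (inv n) ⟨
      ι 7 ℚ.* ι n ℚ.* inv n               ≡⟨ cong (ℚ._* inv n) (ι-* 7 n) ⟨
      ι (7 ℕ.* n) ℚ.* inv n               ≤⟨ *-monoʳ (0≤inv n) (ι-mono (7n≤57[n/8] n (ℕₚ.≤-trans (from-yes (392 ℕₚ.≤? 4 ℕ.* (100 ℕ.* 100))) big))) ⟩
      ι (57 ℕ.* b) ℚ.* inv n              ≡⟨ cong (ℚ._* inv n) (ι-* 57 b) ⟩
      ι 57 ℚ.* ι b ℚ.* inv n              ≡⟨ solve 2 (λ b v → con (ι 57) :* b :* v := con (ι 3) :* (b :* (con (ι 19) :* v))) refl (ι b) (inv n) ⟩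
      ι 3 ℚ.* (ι b ℚ.* (ι 19 ℚ.* inv n))  ≤⟨ *-monoˡ (0≤ι 3) (*-monoˡ (0≤ι b) (*-monoʳ (0≤inv n) 19≤c)) ⟩
      ι 3 ℚ.* (ι b ℚ.* p)                 ∎
    -- From `b p ≥ 7/3` comes `1 + b p ≥ 10/3`.
    s≤3/10 : s ℚ.≤ + 3 ℚ./ 10
    s≤3/10 = begin
      s                                               ≡⟨ solve 1 (λ s → s := con (+ 1 ℚ./ 10) :* (s :* (con (ι 3) :+ con (ι 7)))) refl s ⟩
      (+ 1 ℚ./ 10) ℚ.* (s ℚ.* (ι 3 ℚ.+ ι 7))          ≤⟨ *-monoˡ (0≤inv 10) (*-monoˡ 0≤s (ℚₚ.+-monoʳ-≤ (ι 3) 7≤3bp)) ⟩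
      (+ 1 ℚ./ 10) ℚ.* (s ℚ.* (ι 3 ℚ.+ ι 3 ℚ.* (ι b ℚ.* p)))
        ≡⟨ solve 2 (λ s t → con (+ 1 ℚ./ 10) :* (s :* (con (ι 3) :+ con (ι 3) :* t)) := con (+ 3 ℚ./ 10) :* (s :* (con 1ℚ :+ t))) refl s (ι b ℚ.* p) ⟩
      (+ 3 ℚ./ 10) ℚ.* (s ℚ.* (1ℚ ℚ.+ ι b ℚ.* p))     ≤⟨ *-monoˡ (from-yes (0ℚ ℚₚ.≤? + 3 ℚ./ 10)) ([1-p]^n*[1+np]≤1 b 0≤p p≤1) ⟩
      + 3 ℚ./ 10                                      ∎
    1+q≤ : 1ℚ ℚ.+ q ℚ.* 1ℚ ℚ.≤ + 109 ℚ./ 100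
    1+q≤ = ℚₚ.+-monoʳ-≤ 1ℚ (begin
      q ℚ.* 1ℚ             ≡⟨ ℚₚ.*-identityʳ q ⟩
      q                    ≡⟨ ^-assocʳ (1ℚ ℚ.- p) b 2 ⟨
      s ^ℚ 2               ≤⟨ ^-mono 2 0≤s s≤3/10 ⟩
      (+ 3 ℚ./ 10) ^ℚ 2    ∎)
    0≤1+q : 0ℚ ℚ.≤ 1ℚ ℚ.+ q ℚ.* 1ℚ
    0≤1+q = 0≤+ 0≤1 (0≤* (0≤^ (b ℕ.* 2) (0≤b-a p≤1)) 0≤1)
    4^b≤ : ι 2 ^ℚ (b ℕ.* 2) ℚ.≤ (+ 6 ℚ./ 5) ^ℚ n
    4^b≤ = begin
      ι 2 ^ℚ (b ℕ.* 2)              ≡⟨ cong (ι 2 ^ℚ_) (ℕₚ.*-comm b 2) ⟩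
      ι 2 ^ℚ (2 ℕ.* b)              ≡⟨ ^-assocʳ (ι 2) 2 b ⟨
      -- `(6/5)^8` is about `4.3`, which exceeds `4`, and `8 b ≤ n`.
      (ι 2 ^ℚ 2) ^ℚ b               ≤⟨ ^-mono b (0≤^ 2 (0≤ι 2)) (from-yes (ι 2 ^ℚ 2 ℚₚ.≤? (+ 6 ℚ./ 5) ^ℚ 8)) ⟩
      ((+ 6 ℚ./ 5) ^ℚ 8) ^ℚ b       ≡⟨ ^-assocʳ (+ 6 ℚ./ 5) 8 b ⟩
      (+ 6 ℚ./ 5) ^ℚ (8 ℕ.* b)      ≤⟨ ^-monoʳ (from-yes (1ℚ ℚₚ.≤? + 6 ℚ./ 5)) (subst (ℕ._≤ n) (ℕₚ.*-comm b 8) (m/n*n≤m n 8)) ⟩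
      (+ 6 ℚ./ 5) ^ℚ n              ∎

-- With V = 1 + 1/y, the factors ((n+1) V^n (1+qz)^n)^k ≤ (V^{3k})^n and
-- (y^k)^{n/A} of the bound on 𝕋^k are at most (5/4)^n each.
module _ (k : ℕ) .{{_ : NonZero k}} where

  private
    y : ℕ
    y = 15 ℕ.* k

    instance
      y≢0 : NonZero y
      y≢0 = ℕₚ.m*n≢0 15 k

    x V : ℚ
    x = inv y
    V = 1ℚ ℚ.+ x

    5*3kx≡1 : ι 5 ℚ.* (ι (3 ℕ.* k) ℚ.* x) ≡ 1ℚ
    5*3kx≡1 = begin
      ι 5 ℚ.* (ι (3 ℕ.* k) ℚ.* x)    ≡⟨ ℚₚ.*-assoc (ι 5) (ι (3 ℕ.* k)) x ⟨
      ι 5 ℚ.* ι (3 ℕ.* k) ℚ.* x      ≡⟨ cong (ℚ._* x) (ι-* 5 (3 ℕ.* k)) ⟨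
      ι (5 ℕ.* (3 ℕ.* k)) ℚ.* x      ≡⟨ cong (λ m → ι m ℚ.* x) (ℕₚ.*-assoc 5 3 k) ⟨
      ι y ℚ.* x                      ≡⟨ ι*inv y ⟩
      1ℚ                             ∎
      where open ≡-Reasoning

  -- `y = 15 k` is chosen so that `3 k x = 1/5`; then `V^(3k) ≤ 1 / (1 - 1/5) = 5/4`.
  V^3k≤5/4 : V ^ℚ (3 ℕ.* k) ℚ.≤ + 5 ℚ./ 4
  V^3k≤5/4 = begin
    v
      ≡⟨ solve 1 (λ v → v := con (inv 4) :* (v :* (con (ι 5) :- con 1ℚ))) refl v ⟩
    inv 4 ℚ.* (v ℚ.* (ι 5 ℚ.- 1ℚ))
      ≡⟨ cong (λ t → inv 4 ℚ.* (v ℚ.* (ι 5 ℚ.- t))) 5*3kx≡1 ⟨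
    inv 4 ℚ.* (v ℚ.* (ι 5 ℚ.- ι 5 ℚ.* (ι (3 ℕ.* k) ℚ.* x)))
      ≡⟨ solve 2 (λ v t → con (inv 4) :* (v :* (con (ι 5) :- con (ι 5) :* t)) := con (+ 5 ℚ./ 4) :* (v :* (con 1ℚ :- t))) refl v (ι (3 ℕ.* k) ℚ.* x) ⟩
    (+ 5 ℚ./ 4) ℚ.* (v ℚ.* (1ℚ ℚ.- ι (3 ℕ.* k) ℚ.* x))
      ≤⟨ *-monoˡ (from-yes (0ℚ ℚₚ.≤? + 5 ℚ./ 4)) ([1+x]^n*[1-nx]≤1 (3 ℕ.* k) (0≤inv y) (inv≤1 y)) ⟩
    + 5 ℚ./ 4 ∎
    where
    open ℚₚ.≤-Reasoning
    v = V ^ℚ (3 ℕ.* k)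

  -- Bernoulli's inequality with `d = 1/4`: the exponent `A = 4 y^k` gives `(5/4)^A ≥ 1 + y^k`.
  y^k≤[5/4]^A : ι y ^ℚ k ℚ.≤ (+ 5 ℚ./ 4) ^ℚ (4 ℕ.* y ℕ.^ k)
  y^k≤[5/4]^A = begin
    ι y ^ℚ k                                ≡⟨ ι-^ y k ⟨
    t                                       ≡⟨ solve 1 (λ t → t := con 0ℚ :+ con (ι 4) :* t :* con (inv 4)) refl t ⟩
    0ℚ ℚ.+ ι 4 ℚ.* t ℚ.* inv 4              ≤⟨ ℚₚ.+-monoˡ-≤ (ι 4 ℚ.* t ℚ.* inv 4) 0≤1 ⟩
    1ℚ ℚ.+ ι 4 ℚ.* t ℚ.* inv 4              ≡⟨ cong (λ s → 1ℚ ℚ.+ s ℚ.* inv 4) (ι-* 4 (y ℕ.^ k)) ⟨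
    1ℚ ℚ.+ ι (4 ℕ.* y ℕ.^ k) ℚ.* inv 4                    ≤⟨ bernoulli (4 ℕ.* y ℕ.^ k) (from-yes (0ℚ ℚₚ.≤? 1ℚ ℚ.+ inv 4)) ⟩
    (+ 5 ℚ./ 4) ^ℚ (4 ℕ.* y ℕ.^ k)                        ∎
    where
    open ℚₚ.≤-Reasoning
    t = ι (y ℕ.^ k)

module DenseBound (τ : TieBreaking) (k y A : ℕ) .{{_ : NonZero y}} .{{_ : NonZero A}}
  (V^3k≤5/4 : (1ℚ ℚ.+ inv y) ^ℚ (3 ℕ.* k) ℚ.≤ + 5 ℚ./ 4)
  (y^k≤[5/4]^A : ι y ^ℚ k ℚ.≤ (+ 5 ℚ./ 4) ^ℚ A) where

  private
    x z V : ℚ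
    x = inv y
    z = ι y ℚ.- 1ℚ
    V = 1ℚ ℚ.+ x

    1+z≡y : 1ℚ ℚ.+ z ≡ ι y
    1+z≡y = solve 1 (λ y → con 1ℚ :+ (y :- con 1ℚ) := y) refl (ι y)

    0≤V : 0ℚ ℚ.≤ V
    0≤V = 0≤+ 0≤1 (0≤inv y)

    1≤y : 1ℚ ℚ.≤ ι y
    1≤y = ι-mono {1} {y} (ℕ.>-nonZero⁻¹ y)

  -- From `p n ≥ 2 A y²` and `a ≥ n / (2 A)` follows `a p ≥ y²`, which makes `q` at most `1 / y²`.
  denseThreshold : ℕ
  denseThreshold = 2 ℕ.* A ℕ.* (y ℕ.* y)

  module _ {n : ℕ} {p : ℚ} (0≤p : 0ℚ ℚ.≤ p) (p≤1 : p ℚ.≤ 1ℚ)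
    (pn-large : ι denseThreshold ℚ.≤ p ℚ.* ι n) (4y²≤n : 4 ℕ.* (y ℕ.* y) ℕ.≤ n) (A≤n : A ℕ.≤ n) where

    private
      a : ℕ
      a = n ℕ./ A
      q : ℚ
      q = (1ℚ ℚ.- p) ^ℚ a
      0≤q : 0ℚ ℚ.≤ q
      0≤q = 0≤^ a (0≤b-a p≤1)

      n≤2Aa : n ℕ.≤ 2 ℕ.* A ℕ.* a
      n≤2Aa = begin
        n                          ≡⟨ m≡m%n+[m/n]*n n A ⟩
        n ℕ.% A ℕ.+ a ℕ.* A        ≤⟨ ℕₚ.+-monoˡ-≤ (a ℕ.* A) (ℕₚ.<⇒≤ (m%n<n n A)) ⟩
        -- `A ≤ n` gives `a ≥ 1`, so the bound `A` on the remainder is at most `a A`.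
        A ℕ.+ a ℕ.* A              ≤⟨ ℕₚ.+-monoˡ-≤ (a ℕ.* A) (ℕₚ.m≤n*m A a {{ℕ.>-nonZero (m≥n⇒m/n>0 A≤n)}}) ⟩
        a ℕ.* A ℕ.+ a ℕ.* A        ≡⟨ ℕ-solve 2 (λ a b → a ⊠ b ⊞ a ⊠ b ≐ ℕ-con 2 ⊠ b ⊠ a) refl a A ⟩
        2 ℕ.* A ℕ.* a              ∎
        where open ℕₚ.≤-Reasoning

      y²≤ap : ι (y ℕ.* y) ℚ.≤ ι a ℚ.* p
      y²≤ap = ℚₚ.*-cancelˡ-≤-pos (ι (2 ℕ.* A)) {{ℚₚ.normalize-pos (2 ℕ.* A) 1 {{_}} {{ℕₚ.m*n≢0 2 A}}}} (begin
        ι (2 ℕ.* A) ℚ.* ι (y ℕ.* y)    ≡⟨ ι-* (2 ℕ.* A) (y ℕ.* y) ⟨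
        ι denseThreshold               ≤⟨ pn-large ⟩
        p ℚ.* ι n                      ≤⟨ *-monoˡ 0≤p (ι-mono n≤2Aa) ⟩
        p ℚ.* ι (2 ℕ.* A ℕ.* a)        ≡⟨ cong (p ℚ.*_) (ι-* (2 ℕ.* A) a) ⟩
        p ℚ.* (ι (2 ℕ.* A) ℚ.* ι a)    ≡⟨ solve 3 (λ p b a → p :* (b :* a) := b :* (a :* p)) refl p (ι (2 ℕ.* A)) (ι a) ⟩
        ι (2 ℕ.* A) ℚ.* (ι a ℚ.* p)    ∎)
        where open ℚₚ.≤-Reasoning

      -- `q (1 + a p) ≤ 1` and `a p ≥ y²` give `q y² ≤ 1`; hence `q z ≤ q y ≤ 1/y`.
      qz≤x : q ℚ.* z ℚ.≤ x
      qz≤x = begin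
        q ℚ.* z                              ≤⟨ *-monoˡ 0≤q (ℚₚ.+-monoʳ-≤ (ι y) (from-yes (ℚ.- 1ℚ ℚₚ.≤? 0ℚ))) ⟩
        q ℚ.* (ι y ℚ.+ 0ℚ)                   ≡⟨ solve 2 (λ q y → q :* (y :+ con 0ℚ) := q :* y :* con 1ℚ) refl q (ι y) ⟩
        q ℚ.* ι y ℚ.* 1ℚ                     ≡⟨ cong (q ℚ.* ι y ℚ.*_) (ι*inv y) ⟨
        q ℚ.* ι y ℚ.* (ι y ℚ.* x)            ≡⟨ solve 3 (λ q y x → q :* y :* (y :* x) := q :* (y :* y) :* x) refl q (ι y) x ⟩
        q ℚ.* (ι y ℚ.* ι y) ℚ.* x            ≡⟨ cong (λ t → q ℚ.* t ℚ.* x) (ι-* y y) ⟨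
        q ℚ.* ι (y ℕ.* y) ℚ.* x              ≤⟨ *-monoʳ (0≤inv y) (*-monoˡ 0≤q y²≤ap) ⟩
        q ℚ.* (ι a ℚ.* p) ℚ.* x              ≡⟨ cong (λ t → q ℚ.* t ℚ.* x) (ℚₚ.+-identityˡ (ι a ℚ.* p)) ⟨
        q ℚ.* (0ℚ ℚ.+ ι a ℚ.* p) ℚ.* x       ≤⟨ *-monoʳ (0≤inv y) (*-monoˡ 0≤q (ℚₚ.+-monoˡ-≤ (ι a ℚ.* p) 0≤1)) ⟩
        q ℚ.* (1ℚ ℚ.+ ι a ℚ.* p) ℚ.* x       ≤⟨ *-monoʳ (0≤inv y) ([1-p]^n*[1+np]≤1 a 0≤p p≤1) ⟩
        1ℚ ℚ.* x                             ≡⟨ ℚₚ.*-identityˡ x ⟩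
        x                                    ∎
        where open ℚₚ.≤-Reasoning

      0≤z : 0ℚ ℚ.≤ z
      0≤z = 0≤b-a 1≤y

      -- Besides `y^a` the bound has the factors `(1 + x)^n`, `n + 1` and `(1 + q z)^n`, each at
      -- most `V^n`.
      𝕋≤V^3n*y^a : 𝕋ℚ τ n p ℚ.≤ V ^ℚ (3 ℕ.* n) ℚ.* ι y ^ℚ a
      𝕋≤V^3n*y^a = begin
        𝕋ℚ τ n p
          ≤⟨ 𝕋≤ τ {n} 0≤p p≤1 (0≤inv y) 0≤z (trans (cong (x ℚ.*_) 1+z≡y) (trans (ℚₚ.*-comm x (ι y)) (ι*inv y))) a ⟩
        V ^ℚ n ℚ.* ι (suc n) ℚ.* ((1ℚ ℚ.+ z) ^ℚ a ℚ.* R ^ℚ n)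
          ≡⟨ cong (λ t → V ^ℚ n ℚ.* ι (suc n) ℚ.* (t ^ℚ a ℚ.* R ^ℚ n)) 1+z≡y ⟩
        V ^ℚ n ℚ.* ι (suc n) ℚ.* (ι y ^ℚ a ℚ.* R ^ℚ n)
          ≤⟨ *-mono (0≤* (0≤^ n 0≤V) (0≤ι (suc n))) (0≤* (0≤^ a (0≤ι y)) (0≤^ n 0≤R))
               (*-monoˡ (0≤^ n 0≤V) (linear≤exponential y n 4y²≤n))
               (*-monoˡ (0≤^ a (0≤ι y)) (^-mono n 0≤R (ℚₚ.+-monoʳ-≤ 1ℚ qz≤x))) ⟩
        V ^ℚ n ℚ.* V ^ℚ n ℚ.* (ι y ^ℚ a ℚ.* V ^ℚ n)
          ≡⟨ solve 2 (λ v w → v :* v :* (w :* v) := (v :* (v :* (v :* con 1ℚ))) :* w) refl (V ^ℚ n) (ι y ^ℚ a) ⟩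
        (V ^ℚ n) ^ℚ 3 ℚ.* ι y ^ℚ a
          ≡⟨ cong (ℚ._* ι y ^ℚ a) (trans (^-assocʳ V n 3) (cong (V ^ℚ_) (ℕₚ.*-comm n 3))) ⟩
        V ^ℚ (3 ℕ.* n) ℚ.* ι y ^ℚ a ∎
        where
        open ℚₚ.≤-Reasoning
        R = 1ℚ ℚ.+ q ℚ.* z
        0≤R : 0ℚ ℚ.≤ R
        0≤R = 0≤+ 0≤1 (0≤* 0≤q 0≤z)

    dense : 𝕋ℚ τ n p ^ℚ k ℚ.≤ ι 2 ^ℚ n
    dense = begin
      𝕋ℚ τ n p ^ℚ k
        ≤⟨ ^-mono k (ℚₚ.≤-trans 0≤1 (1≤𝕋 τ {n} 0≤p p≤1)) 𝕋≤V^3n*y^a ⟩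
      (V ^ℚ (3 ℕ.* n) ℚ.* ι y ^ℚ a) ^ℚ k
        ≡⟨ ^-distrib-* (V ^ℚ (3 ℕ.* n)) (ι y ^ℚ a) k ⟩
      (V ^ℚ (3 ℕ.* n)) ^ℚ k ℚ.* (ι y ^ℚ a) ^ℚ k
        ≡⟨ cong₂ ℚ._*_ (trans (^-assocʳ V (3 ℕ.* n) k) (cong (V ^ℚ_) (ℕ-solve 2 (λ n k → ℕ-con 3 ⊠ n ⊠ k ≐ ℕ-con 3 ⊠ k ⊠ n) refl n k)))
                       (trans (^-assocʳ (ι y) a k) (cong (ι y ^ℚ_) (ℕₚ.*-comm a k))) ⟩
      V ^ℚ (3 ℕ.* k ℕ.* n) ℚ.* ι y ^ℚ (k ℕ.* a)
        ≡⟨ cong₂ ℚ._*_ (^-assocʳ V (3 ℕ.* k) n) (^-assocʳ (ι y) k a) ⟨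
      (V ^ℚ (3 ℕ.* k)) ^ℚ n ℚ.* (ι y ^ℚ k) ^ℚ a
        ≤⟨ *-mono (0≤^ n (0≤^ (3 ℕ.* k) 0≤V)) (0≤^ a (0≤^ k (0≤ι y)))
             (^-mono n (0≤^ (3 ℕ.* k) 0≤V) V^3k≤5/4) (^-mono a (0≤^ k (0≤ι y)) y^k≤[5/4]^A) ⟩
      (+ 5 ℚ./ 4) ^ℚ n ℚ.* ((+ 5 ℚ./ 4) ^ℚ A) ^ℚ a
        ≡⟨ cong ((+ 5 ℚ./ 4) ^ℚ n ℚ.*_) (trans (^-assocʳ (+ 5 ℚ./ 4) A a) (cong ((+ 5 ℚ./ 4) ^ℚ_) (ℕₚ.*-comm A a))) ⟩
      (+ 5 ℚ./ 4) ^ℚ n ℚ.* (+ 5 ℚ./ 4) ^ℚ (a ℕ.* A)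
        ≤⟨ *-monoˡ (0≤^ n (from-yes (0ℚ ℚₚ.≤? + 5 ℚ./ 4))) (^-monoʳ (from-yes (1ℚ ℚₚ.≤? + 5 ℚ./ 4)) (m/n*n≤m n A)) ⟩
      (+ 5 ℚ./ 4) ^ℚ n ℚ.* (+ 5 ℚ./ 4) ^ℚ n
        ≡⟨ ^-distrib-* (+ 5 ℚ./ 4) (+ 5 ℚ./ 4) n ⟨
      ((+ 5 ℚ./ 4) ℚ.* (+ 5 ℚ./ 4)) ^ℚ n
        ≤⟨ ^-mono n (from-yes (0ℚ ℚₚ.≤? (+ 5 ℚ./ 4) ℚ.* (+ 5 ℚ./ 4))) (from-yes ((+ 5 ℚ./ 4) ℚ.* (+ 5 ℚ./ 4) ℚₚ.≤? ι 2)) ⟩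
      ι 2 ^ℚ n ∎
      where open ℚₚ.≤-Reasoning

  sizeThreshold : ℕ
  sizeThreshold = denseThreshold ℕ.⊔ 4 ℕ.* (y ℕ.* y) ℕ.⊔ A

  dense-clamped : ∀ {n p} → ι denseThreshold ℚ.≤ p ℚ.* ι n → sizeThreshold ℕ.≤ n →
    𝕋ℚ τ n (clamp p) ^ℚ k ℚ.≤ ι 2 ^ℚ n
  dense-clamped {n} {p} pn-large n-large = dense {n} (0≤clamp p) (clamp≤1 p)
    (c≤pn⇒c≤clamp[p]n {p} {ι denseThreshold} n pn-large (ι-mono (ℕₚ.m⊔n≤o⇒m≤o denseThreshold _ h)))
    (ℕₚ.m⊔n≤o⇒n≤o denseThreshold _ h)
    (ℕₚ.m⊔n≤o⇒n≤o (denseThreshold ℕ.⊔ 4 ℕ.* (y ℕ.* y)) A n-large)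
    where h = ℕₚ.m⊔n≤o⇒m≤o (denseThreshold ℕ.⊔ 4 ℕ.* (y ℕ.* y)) A n-large

  1≤2^n*𝕋^k : ∀ n p → 1ℚ ℚ.≤ ι 2 ^ℚ n ℚ.* 𝕋ℚ τ n (clamp p) ^ℚ k
  1≤2^n*𝕋^k n p = subst (ℚ._≤ ι 2 ^ℚ n ℚ.* 𝕋ℚ τ n (clamp p) ^ℚ k) (ℚₚ.*-identityˡ 1ℚ)
    (*-mono 0≤1 0≤1 (1≤^ n (ι-mono {1} {2} (s≤s z≤n))) (1≤^ k (1≤𝕋 τ {n} (0≤clamp p) (clamp≤1 p))))

  -- Replacing each late term of `p` by its clamped value costs at most the `ε` that the order on
  -- reals allows; at the clamped value the rational bounds apply.
  dense-case : (p : ℕ → ℝ) → (∀ n → 0ℝ ≤ p n × p n ≤ 1ℝ) → (λ n → p n * fromℕ n) ⟶∞ →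
    ∃[ N ] (∀ n → N ℕ.≤ n → 𝕋 τ n (p n) ^ k ≤ 2ℝ ^ n × 1ℝ ≤ 2ℝ ^ n * 𝕋 τ n (p n) ^ k)
  dense-case p 0≤p≤1 pn→∞ = N₀ ℕ.⊔ sizeThreshold , λ n n-large →
    upper n (proj₂ (pn→∞ K) n (ℕₚ.m⊔n≤o⇒m≤o N₀ _ n-large)) (ℕₚ.m⊔n≤o⇒n≤o N₀ _ n-large) , lower n
    where
    -- The extra 1 absorbs the slack `ε = 1` in the real inequality, so that late terms of `p n`
    -- reach the threshold itself.
    K = fromℕ (suc denseThreshold)
    N₀ = proj₁ (pn→∞ K)

    p∼clamp : ∀ n → seq (p n) ∼ (clamp ∘ seq (p n))
    p∼clamp n = clamp-∼ (p n) (proj₁ (0≤p≤1 n)) (proj₂ (0≤p≤1 n))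

    seq-upper : ∀ n x j → seq (𝕋 τ n x ^ k) j ≡ 𝕋ℚ τ n (seq x j) ^ℚ k
    seq-upper n x j = trans (seq-^ (𝕋 τ n x) k j) (cong (_^ℚ k) (seq-𝕋 τ n x j))

    seq-lower : ∀ n x j → seq (2ℝ ^ n * 𝕋 τ n x ^ k) j ≡ ι 2 ^ℚ n ℚ.* 𝕋ℚ τ n (seq x j) ^ℚ k
    seq-lower n x j = cong₂ ℚ._*_ (seq-^ 2ℝ n j) (seq-upper n x j)

    upper : ∀ n → K ≤ p n * fromℕ n → sizeThreshold ℕ.≤ n → 𝕋 τ n (p n) ^ k ≤ 2ℝ ^ n
    upper n K≤pn n-large ε 0<ε = N₁ ℕ.⊔ N₂ , λ j j-large →
      let q = seq (p n) j
          Φ = λ q → 𝕋ℚ τ n q ^ℚ k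
          close = proj₂ continuity j (ℕₚ.m⊔n≤o⇒m≤o N₁ N₂ j-large)
          bound = dense-clamped {n} {q} (pn-large j (ℕₚ.m⊔n≤o⇒n≤o N₁ N₂ j-large)) n-large
      in subst₂ (λ s t → s ℚ.≤ t ℚ.+ ε) (sym (seq-upper n (p n) j)) (sym (seq-^ 2ℝ n j))
           (ℚₚ.≤-trans (a≤b+∣a-b∣ (Φ q) (Φ (clamp q)) close) (ℚₚ.+-monoˡ-≤ ε bound))
      where
      continuity = termwise-continuous (λ x → 𝕋 τ n x ^ k) (λ q → 𝕋ℚ τ n q ^ℚ k) (seq-upper n) (p n) (p∼clamp n) ε 0<ε
      N₁ = proj₁ continuity
      0<1 : 0ℚ ℚ.< 1ℚ
      0<1 = ℚₚ.positive⁻¹ 1ℚ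
      N₂ = proj₁ (K≤pn 1ℚ 0<1)
      pn-large : ∀ j → N₂ ℕ.≤ j → ι denseThreshold ℚ.≤ seq (p n) j ℚ.* ι n
      pn-large j h = begin
        ι K₀                                           ≡⟨ solve 1 (λ t → t := (con 1ℚ :+ t) :- con 1ℚ) refl (ι K₀) ⟩
        (1ℚ ℚ.+ ι K₀) ℚ.- 1ℚ                            ≡⟨ cong (ℚ._- 1ℚ) (ι-+ 1 K₀) ⟨
        ι (suc K₀) ℚ.- 1ℚ                               ≤⟨ ℚₚ.+-monoˡ-≤ (ℚ.- 1ℚ) (proj₂ (K≤pn 1ℚ 0<1) j h) ⟩
        seq (p n) j ℚ.* ι n ℚ.+ 1ℚ ℚ.- 1ℚ              ≡⟨ solve 1 (λ t → t :+ con 1ℚ :- con 1ℚ := t) refl (seq (p n) j ℚ.* ι n) ⟩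
        seq (p n) j ℚ.* ι n                            ∎
        where
        open ℚₚ.≤-Reasoning
        K₀ = denseThreshold

    lower : ∀ n → 1ℝ ≤ 2ℝ ^ n * 𝕋 τ n (p n) ^ k
    lower n ε 0<ε = proj₁ continuity , λ j j-large →
      let q = seq (p n) j
          Φ = λ q → ι 2 ^ℚ n ℚ.* 𝕋ℚ τ n q ^ℚ k
          close = subst (ℚ._≤ ε) (∣a-b∣≡∣b-a∣ (Φ q) (Φ (clamp q))) (proj₂ continuity j j-large)
      in subst (λ t → 1ℚ ℚ.≤ t ℚ.+ ε) (sym (seq-lower n (p n) j))
           (ℚₚ.≤-trans (1≤2^n*𝕋^k n q) (a≤b+∣a-b∣ (Φ (clamp q)) (Φ q) close))
      where
      continuity = termwise-continuous (λ x → 2ℝ ^ n * 𝕋 τ n x ^ k) (λ q → ι 2 ^ℚ n ℚ.* 𝕋ℚ τ n q ^ℚ k)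
        (seq-lower n) (p n) (p∼clamp n) ε 0<ε

module _ (τ : TieBreaking) where

  sparse-case : (c : ℝ) → fromℕ 20 ≤ c → ∃[ N ] (∀ n → .{{_ : NonZero n}} → N ℕ.≤ n →
    𝕋 τ n (c /ℕ n) ≤ (2ℝ - fromℚ (+ 1 ℚ./ 100)) ^ n)
  sparse-case c 20≤c = M ℕ.⊔ L , λ n {{n≢0}} n-large ε 0<ε → N₁ ℕ.⊔ N₂ , λ j j-large →
    subst₂ (λ s t → s ℚ.≤ t ℚ.+ ε) (sym (seq-𝕋 τ n (_/ℕ_ c n {{n≢0}}) j)) (sym (seq-^ (2ℝ - fromℚ (+ 1 ℚ./ 100)) n j))
      (ℚₚ.≤-trans
        (sparse τ n {{n≢0}} (seq c j) (19≤c j (ℕₚ.m⊔n≤o⇒n≤o N₁ N₂ j-large))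
          (ℚₚ.≤-trans (c≤M j (ℕₚ.m⊔n≤o⇒m≤o N₁ N₂ j-large)) (ι-mono (ℕₚ.m⊔n≤o⇒m≤o M L n-large)))
          (ℕₚ.m⊔n≤o⇒n≤o M L n-large))
        (a≤a+b (ℚₚ.<⇒≤ 0<ε)))
    where
    0<1 : 0ℚ ℚ.< 1ℚ
    0<1 = ℚₚ.positive⁻¹ 1ℚ
    N₁ = proj₁ (cauchy c 1ℚ 0<1)
    N₂ = proj₁ (20≤c 1ℚ 0<1)
    L = 4 ℕ.* (100 ℕ.* 100)
    -- A natural number above all late terms of `c`: for `n ≥ M` the terms of `c / n` are at most 1.
    M = ℤ.∣ ℚ.↥ (seq c N₁ ℚ.+ 1ℚ) ∣
    c≤M : ∀ j → N₁ ℕ.≤ j → seq c j ℚ.≤ ι M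
    c≤M j h = ℚₚ.≤-trans (a≤b+∣a-b∣ (seq c j) (seq c N₁) (proj₂ (cauchy c 1ℚ 0<1) j N₁ h ℕₚ.≤-refl)) (p≤ι∣↥p∣ (seq c N₁ ℚ.+ 1ℚ))
    -- With slack 1, the real inequality `20 ≤ c` gives 19 for the late terms, hence the constant in
    -- `sparse`.
    19≤c : ∀ j → N₂ ℕ.≤ j → ι 19 ℚ.≤ seq c j
    19≤c j h = begin
      ι 20 ℚ.- 1ℚ             ≤⟨ ℚₚ.+-monoˡ-≤ (ℚ.- 1ℚ) (proj₂ (20≤c 1ℚ 0<1) j h) ⟩
      seq c j ℚ.+ 1ℚ ℚ.- 1ℚ   ≡⟨ solve 1 (λ t → t :+ con 1ℚ :- con 1ℚ := t) refl (seq c j) ⟩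
      seq c j                 ∎
      where open ℚₚ.≤-Reasoning

theorem1 : (τ : TieBreaking) →
    ((p : ℕ → ℝ) → (∀ n → 0ℝ ≤ p n × p n ≤ 1ℝ) →
    (λ n → p n * fromℕ n) ⟶∞ →
    Is2^o[n] (λ n → 𝕋 τ n (p n)))
    ×
    ((c : ℝ) → fromℕ 20 ≤ c →
    ∃[ ε ] (fromℚ (+ 1 ℚ./ 100) ≤ ε ×
    ∃[ N ] (∀ n → .{{_ : NonZero n}} → N ℕ.≤ n →
    𝕋 τ n (c /ℕ n) ≤ (2ℝ - ε) ^ n)))
theorem1 τ = (λ p 0≤p≤1 pn→∞ k → let y = 15 ℕ.* k ; instance y≢0 = ℕₚ.m*n≢0 15 k in
    DenseBound.dense-case τ k y (4 ℕ.* y ℕ.^ k) {{y≢0}} {{ℕₚ.m*n≢0 4 (y ℕ.^ k) {{_}} {{ℕₚ.m^n≢0 y k}}}}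
      (V^3k≤5/4 k) (y^k≤[5/4]^A k) p 0≤p≤1 pn→∞) , λ c 20≤c →
  fromℚ (+ 1 ℚ./ 100) , (λ ε 0<ε → 0 , λ _ _ → a≤a+b (ℚₚ.<⇒≤ 0<ε)) , sparse-case τ c 20≤c
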